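{- Let $\mathcal{E}$ be an election system and let $\delta>0$. The special case of Swap Bribery for $\mathcal{E}$ in which all swap costs are in $\{0,\delta\}$ and the budget is $\beta=0$ is equivalent to the Possible Winner problem for $\mathcal{E}$; that is, each of the two decision problems is polynomial-time many-one reducible to the other.
   Context: Elections. An election consists of a set $C=\{c_1,\dots,c_m\}$ of candidates and votes $V=\{v_1,\dots,v_n\}$; each vote is a strict linear order over $C$ (several voters may have the same order), and $\mathrm{rank}(c,v)$ is the position of $c$ in $v$. An election system $\mathcal{E}$ maps each pair $(C,V)$ to a set $W\subseteq C$ of winners. Swaps. A swap in a vote $v$ is a triple $(v,a,b)$ with $a,b\in C$, $a\ne b$. It is admissible in $v$ if $\mathrm{rank}(a,v)=\mathrm{rank}(b,v)-1$; applying it exchanges the positions of $a$ and $b$ in $v$. A set $\Gamma$ of swaps is admissible in $v$ if its elements can be applied to $v$ one after the other in some order, each being admissible in the vote obtained so far; the resulting vote is $v^{\Gamma}$. This extends vote by vote to several votes, the resulting votes being denoted $V^{\Gamma}$. Swap Bribery for $\mathcal{E}$: given an $\mathcal{E}$-election $(C,V)$, a preferred candidate $p\in C$, a cost function $c$ assigning to each possible swap in each vote a non-negative cost, and a budget $\beta$, decide whether there is an admissible set $\Gamma$ of swaps of total cost at most $\beta$ such that $p$ is a winner in the $\mathcal{E}$-election $(C,V^{\Gamma})$. Possible Winner for $\mathcal{E}$: given a set $C$ of candidates, partial votes $V'=(v'_1,\dots,v'_n)$ (strict partial orders over $C$), and a preferred candidate $p\in C$, decide whether there are linear orders $V=(v_1,\dots,v_n)$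 such that each $v_i$ extends $v'_i$ and $p$ is a winner in the $\mathcal{E}$-election $(C,V)$.
   Formalization: The number δ, the swap costs and the budget are taken to be rational numbers (encoded in binary) rather than arbitrary real numbers. -}

module Defs where

open import Data.Bool.Base using (Bool; true; false; T)
open import Data.Fin.Base using (Fin; toℕ)
open import Data.Fin.Properties using (_≟_)
open import Data.Fin.Permutation.Components using (transpose; transpose-inverse)
open import Data.Integer.Base using (ℤ; +_; -[1+_])
open import Data.List.Base as List using (List; []; _∷_)
open import Data.List.Relation.Binary.Permutation.Propositional using (_↭_)
open import Data.List.Relation.Unary.Unique.Propositional using (Unique)
open import Data.Nat.Base as ℕ using (ℕ; zero; suc; _+_; _*_; _^_; _≤_)
open import Data.Nat.Binary.Base as ℕᵇ using (ℕᵇ; 2[1+_]; 1+[2_])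
open import Data.Product.Base using (Σ; ∃-syntax; Σ-syntax; _×_; _,_; proj₁)
open import Data.Rational.Base as ℚ using (ℚ; 0ℚ; ↥_; ↧ₙ_)
open import Data.Sum.Base using (_⊎_)
open import Data.Vec.Base as Vec using (Vec; lookup; tabulate)
open import Data.Vec.Properties using (lookup∘tabulate)
open import Function.Bundles using (_⇔_)
open import Function.Definitions using (Injective)
open import Level using (0ℓ)
open import Relation.Binary.PropositionalEquality
  using (_≡_; _≢_; sym; trans; cong)
open import Relation.Binary.Structures using (IsStrictPartialOrder)
open import Relation.Nullary using (yes; no)
open import Relation.Unary using (Pred)

------------------------------------------------------------------------
-- Polynomial time
--
-- The machine model is N. D. Jones's one-variable WHILE language over
-- binary trees ("Computability and Complexity from a Programming
-- Perspective", 1997).  Every step is charged the full size of the trees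
-- it reads and writes, so sharing of subtrees is never free and programs
-- and multi-tape Turing machines simulate each other with polynomial
-- overhead, also when computing functions with large outputs.

infixr 5 _∙_

data Tree : Set where
  nil : Tree
  _∙_ : Tree → Tree → Tree

size : Tree → ℕ
size nil     = 1
size (s ∙ t) = suc (size s + size t)

data Expr : Set where
  X    : Expr
  nil  : Expr
  cons : Expr → Expr → Expr
  hd   : Expr → Expr
  tl   : Expr → Expr

head : Tree → Tree
head nil     = nil
head (s ∙ _) = s

tail : Tree → Tree
tail nil     = nil
tail (_ ∙ t) = t

⟦_⟧ : Expr → Tree → Tree
⟦ X        ⟧ x = x
⟦ nil      ⟧ x = nil
⟦ cons e f ⟧ x = ⟦ e ⟧ x ∙ ⟦ f ⟧ x
⟦ hd e     ⟧ x = head (⟦ e ⟧ x)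
⟦ tl e     ⟧ x = tail (⟦ e ⟧ x)

infixr 6 _⨾_

data Program : Set where
  X≔_           : Expr → Program
  _⨾_           : Program → Program → Program
  if_then_else_ : Expr → Program → Program → Program
  while_loop_   : Expr → Program → Program

-- P ⊢ x ⇓ y ⟨ t ⟩ : started with X = x, program P halts with X = y in
-- time t.  A test succeeds when its value is not nil.

infix 4 _⊢_⇓_⟨_⟩

data _⊢_⇓_⟨_⟩ : Program → Tree → Tree → ℕ → Set where
  assign : ∀ {e x} →
    X≔ e ⊢ x ⇓ ⟦ e ⟧ x ⟨ size x + size (⟦ e ⟧ x) ⟩
  seq : ∀ {P Q x y z s t} →
    P ⊢ x ⇓ y ⟨ s ⟩ → Q ⊢ y ⇓ z ⟨ t ⟩ → P ⨾ Q ⊢ x ⇓ z ⟨ s + t ⟩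
  if-true : ∀ {e P Q x y t} →
    ⟦ e ⟧ x ≢ nil → P ⊢ x ⇓ y ⟨ t ⟩ →
    if e then P else Q ⊢ x ⇓ y ⟨ size x + t ⟩
  if-false : ∀ {e P Q x y t} →
    ⟦ e ⟧ x ≡ nil → Q ⊢ x ⇓ y ⟨ t ⟩ →
    if e then P else Q ⊢ x ⇓ y ⟨ size x + t ⟩
  while-stop : ∀ {e P x} →
    ⟦ e ⟧ x ≡ nil → while e loop P ⊢ x ⇓ x ⟨ size x ⟩
  while-step : ∀ {e P x y z s t} →
    ⟦ e ⟧ x ≢ nil → P ⊢ x ⇓ y ⟨ s ⟩ → while e loop P ⊢ y ⇓ z ⟨ t ⟩ →
    while e loop P ⊢ x ⇓ z ⟨ size x + (s + t) ⟩

record DecisionProblem : Set₁ where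
  field
    Instance : Set
    code     : Instance → Tree
    Yes      : Pred Instance 0ℓ

open DecisionProblem

Restrict : (A : DecisionProblem) → Pred (Instance A) 0ℓ → DecisionProblem
Restrict A Q = record
  { Instance = Σ (Instance A) Q
  ; code     = λ x → code A (proj₁ x)
  ; Yes      = λ x → Yes A (proj₁ x)
  }

-- Every polynomial is bounded by k * n ^ k + k for some k.

PolyTime : (A B : DecisionProblem) → (Instance A → Instance B) → Set
PolyTime A B f =
  ∃[ P ] ∃[ k ] ∀ x → ∃[ t ]
    (P ⊢ code A x ⇓ code B (f x) ⟨ t ⟩) × t ≤ k * size (code A x) ^ k + k

infix 4 _≤ₚ_

_≤ₚ_ : DecisionProblem → DecisionProblem → Set
A ≤ₚ B = Σ[ f ∈ (Instance A → Instance B) ]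
  (∀ x → Yes A x ⇔ Yes B (f x)) × PolyTime A B f

------------------------------------------------------------------------
-- Elections
--
-- The candidate set {c₁, …, cₘ} is Fin m.  A vote is given by the
-- positions of the candidates: a is preferred to b when rank v a is
-- smaller than rank v b.  Injectivity is irrelevant, so that votes with
-- the same ranks are equal and no election system can tell them apart.

record Vote (m : ℕ) : Set where
  constructor mkVote
  field
    ranks      : Vec (Fin m) m
    .injective : Injective _≡_ _≡_ (lookup ranks)

  rank : Fin m → Fin m
  rank = lookup ranks

open Vote public

-- E m n V c : candidate c is a winner in the election (Fin m, V).

ElectionSystem : Set₁
ElectionSystem = ∀ m n → Vec (Vote m) n → Pred (Fin m) 0ℓ

------------------------------------------------------------------------
-- Swaps

record Swap (m : ℕ) : Set where
  constructor mkSwap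
  field
    fst snd   : Fin m
    .distinct : fst ≢ snd

transpose-injective : ∀ {m} (a b : Fin m) → Injective _≡_ _≡_ (transpose a b)
transpose-injective a b eq =
  trans (sym (transpose-inverse b a))
        (trans (cong (transpose b a) eq) (transpose-inverse b a))

applySwap : ∀ {m} → Swap m → Vote m → Vote m
applySwap {m} (mkSwap a b _) v@(mkVote _ inj) =
  mkVote (tabulate new) λ {c} {d} eq →
    transpose-injective a b
      (inj (trans (sym (lookup∘tabulate new c))
                  (trans eq (lookup∘tabulate new d))))
  where
  new : Fin m → Fin m
  new c = rank v (transpose a b c)

Admissible : ∀ {m} → Swap m → Vote m → Set
Admissible (mkSwap a b _) v = suc (toℕ (rank v a)) ≡ toℕ (rank v b)

data _⟶[_]_ {m : ℕ} : Vote m → List (Swap m) → Vote m → Set where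
  done : ∀ {v} → v ⟶[ [] ] v
  step : ∀ {v w s σ} →
    Admissible s v → applySwap s v ⟶[ σ ] w → v ⟶[ s ∷ σ ] w

-- A finite set of swaps, as a list without repetitions.

record SwapSet (m : ℕ) : Set where
  constructor mkSwapSet
  field
    elements : List (Swap m)
    unique   : Unique elements

open SwapSet public

-- v ⟶^ Γ , w : the set Γ is admissible in v and v^Γ is w.

_⟶^_,_ : ∀ {m} → Vote m → SwapSet m → Vote m → Set
v ⟶^ Γ , w = ∃[ σ ] σ ↭ elements Γ × v ⟶[ σ ] w

sumℚ : List ℚ → ℚ
sumℚ = List.foldr ℚ._+_ 0ℚ

totalCost : ∀ {m n} → (Fin n → Swap m → ℚ) → (Fin n → SwapSet m) → ℚ
totalCost c Γ =
  sumℚ (List.tabulate λ i → sumℚ (List.map (c i) (elements (Γ i))))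

------------------------------------------------------------------------
-- Partial votes

record PartialVote (m : ℕ) : Set where
  field
    prefers : Fin m → Fin m → Bool
    isStrictPartialOrder :
      IsStrictPartialOrder _≡_ (λ a b → T (prefers a b))

open PartialVote public

_Extends_ : ∀ {m} → Vote m → PartialVote m → Set
v Extends u = ∀ a b → T (prefers u a b) → toℕ (rank v a) ℕ.< toℕ (rank v b)

------------------------------------------------------------------------
-- Instances

record SwapBriberyInstance : Set where
  field
    m n       : ℕ
    votes     : Vec (Vote m) n
    preferred : Fin m
    cost      : Fin n → Swap m → ℚ
    cost≥0    : ∀ i s → 0ℚ ℚ.≤ cost i s
    budget    : ℚ

record PossibleWinnerInstance : Set where
  field
    m n       : ℕ
    votes     : Vec (PartialVote m) n
    preferred : Fin m

-- Encodings: candidates, ranks and the number of candidates are unary,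
-- the numbers making up a cost or the budget are binary.

codeList : List Tree → Tree
codeList = List.foldr _∙_ nil

codeTable : ∀ {n} → (Fin n → Tree) → Tree
codeTable f = codeList (List.tabulate f)

codeUnary : ℕ → Tree
codeUnary zero    = nil
codeUnary (suc n) = nil ∙ codeUnary n

codeFin : ∀ {n} → Fin n → Tree
codeFin i = codeUnary (toℕ i)

codeBool : Bool → Tree
codeBool false = nil
codeBool true  = nil ∙ nil

codeℕᵇ : ℕᵇ → Tree
codeℕᵇ ℕᵇ.zero  = nil
codeℕᵇ 2[1+ b ] = nil ∙ codeℕᵇ b
codeℕᵇ 1+[2 b ] = (nil ∙ nil) ∙ codeℕᵇ b

codeℕ : ℕ → Tree
codeℕ n = codeℕᵇ (ℕᵇ.fromℕ n)

codeℤ : ℤ → Tree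
codeℤ (+ n)    = nil ∙ codeℕ n
codeℤ -[1+ n ] = (nil ∙ nil) ∙ codeℕ n

codeℚ : ℚ → Tree
codeℚ q = codeℤ (↥ q) ∙ codeℕ (↧ₙ q)

codeVote : ∀ {m} → Vote m → Tree
codeVote v = codeTable λ c → codeFin (rank v c)

codePartialVote : ∀ {m} → PartialVote m → Tree
codePartialVote u = codeTable λ a → codeTable λ b → codeBool (prefers u a b)

-- The diagonal of the cost matrix is left blank (nil codes no rational).

codeCost : ∀ {m} → (Swap m → ℚ) → Fin m → Fin m → Tree
codeCost c a b with a ≟ b
... | yes _  = nil
... | no a≢b = codeℚ (c (mkSwap a b a≢b))

codeCosts : ∀ {m} → (Swap m → ℚ) → Tree
codeCosts c = codeTable λ a → codeTable λ b → codeCost c a b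

------------------------------------------------------------------------
-- The decision problems

SwapBribery : ElectionSystem → DecisionProblem
SwapBribery E = record
  { Instance = SwapBriberyInstance
  ; code     = λ x → let open SwapBriberyInstance x in
      codeUnary m
        ∙ codeTable (λ i → codeVote (lookup votes i))
        ∙ codeFin preferred
        ∙ codeTable (λ i → codeCosts (cost i))
        ∙ codeℚ budget
  ; Yes      = λ x → let open SwapBriberyInstance x in
      Σ[ Γ ∈ (Fin n → SwapSet m) ] Σ[ W ∈ Vec (Vote m) n ]
        (∀ i → lookup votes i ⟶^ Γ i , lookup W i)
        × totalCost cost Γ ℚ.≤ budget
        × E m n W preferred
  }

PossibleWinner : ElectionSystem → DecisionProblem
PossibleWinner E = record
  { Instance = PossibleWinnerInstance
  ; code     = λ x → let open PossibleWinnerInstance x in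
      codeUnary m
        ∙ codeTable (λ i → codePartialVote (lookup votes i))
        ∙ codeFin preferred
  ; Yes      = λ x → let open PossibleWinnerInstance x in
      Σ[ W ∈ Vec (Vote m) n ]
        (∀ i → lookup W i Extends lookup votes i)
        × E m n W preferred
  }

ZeroOrδ : ℚ → Pred SwapBriberyInstance 0ℓ
ZeroOrδ δ x = let open SwapBriberyInstance x in
  (∀ i s → cost i s ≡ 0ℚ ⊎ cost i s ≡ δ) × budget ≡ 0ℚ

{-# OPTIONS --safe #-}

-- With budget 0 only free swaps are available.  A free admissible set can
-- turn a vote v into w exactly when w keeps a above b for every pair a, b with
-- a above b in v whose swap costs δ: no set of free swaps inverts such a pair,
-- and bubble sort from v to w uses each remaining inverted pair once.  So
-- Swap Bribery becomes Possible Winner for the transitive closures of these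
-- relations.  Conversely, a partial vote u becomes a linear extension of u in
-- which exactly the swaps of pairs ordered by u cost δ.
--
-- Both maps are polynomial-time: Warshall's algorithm gives the closure,
-- sorting by the sizes of the down-sets gives the linear extension, and all
-- recursion is by folds whose accumulator grows in each round by an amount
-- that does not depend on the accumulator.

module Submission where

open import Defs
open import Data.Bool.Base using (Bool; true; false; T; not; _∧_; _∨_)
open import Data.Bool.Properties using (T-≡; T-∨; T-∧)
open import Data.Fin.Base using (Fin; zero; suc; toℕ; fromℕ<; combine; remQuot; punchOut)
open import Data.Fin.Permutation.Components using (transpose)
open import Data.Fin.Properties
  using (_≟_; any?; toℕ-injective; toℕ<n; toℕ-fromℕ<; fromℕ<-injective; remQuot-combine; punchOut-injective; injective⇒≤)
open import Data.Fin.Subset using (∣_∣; _∈_)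
open import Data.Fin.Subset.Properties using (p⊂q⇒∣p∣<∣q∣; ∣p∣≤n)
import Data.Integer.Base as ℤ
open import Data.List.Base as List using (List; []; _∷_; foldl; allFin)
import Data.List.Membership.Propositional as List
open import Data.List.Membership.Propositional.Properties using (∈-allFin)
open import Data.List.Relation.Binary.Permutation.Propositional using (↭-refl; ↭-sym)
open import Data.List.Relation.Binary.Permutation.Propositional.Properties using (All-resp-↭)
open import Data.List.Relation.Unary.All as All using (All; []; _∷_)
open import Data.List.Relation.Unary.All.Properties as All using ()
open import Data.List.Relation.Unary.AllPairs using ([]; _∷_)
open import Data.List.Relation.Unary.Any using (here; there)
open import Data.List.Relation.Unary.Unique.Propositional using (Unique)
open import Data.Nat.Base as ℕ using (ℕ; zero; suc; _+_; _*_; _^_; _≤_; _<ᵇ_; z≤n; s≤s; NonZero; >-nonZero)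
import Data.Nat.DivMod as ℕ
open import Data.Nat.Induction using (<-wellFounded)
open import Data.Nat.Properties as ℕ hiding (_≟_)
open import Data.Nat.Solver using (module +-*-Solver)
open import Data.Product.Base using (_×_; _,_; proj₁; proj₂; uncurry; ∃-syntax; Σ-syntax)
open import Data.Rational.Base as ℚ using (ℚ; 0ℚ; mkℚ; _<_)
import Data.Rational.Properties as ℚ
open import Data.Sum.Base using (_⊎_; inj₁; inj₂)
open import Data.Unit.Base using (tt)
open import Data.Vec.Base using (Vec; lookup; tabulate)
open import Data.Vec.Properties using (lookup∘tabulate; tabulate∘lookup; tabulate-cong; lookup⇒[]=; []=⇒lookup)
open import Function.Base using (_∘_; id)
open import Function.Bundles using (_⇔_; mk⇔; Equivalence)
open import Function.Construct.Composition using (_⇔-∘_)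
open import Function.Construct.Symmetry using (⇔-sym)
open import Induction.WellFounded as WF using (Acc)
open import Relation.Binary.Definitions using (tri<; tri≈; tri>)
open import Relation.Binary.PropositionalEquality
  using (_≡_; _≢_; refl; sym; trans; cong; cong₂; subst; subst₂; isEquivalence)
open import Relation.Binary.Structures using (IsStrictPartialOrder)
open import Relation.Nullary using (¬_; Dec; yes; no; isYes; contradiction; recompute)
open import Relation.Nullary.Decidable using (_×-dec_; toWitness; fromWitness; decidable-stable)

open +-*-Solver using (solve; _:+_; _:*_; _:=_; con)
open DecisionProblem
open Equivalence using (to; from)

-- The election system is a black box, so both reductions preserve the whole set of attainable
-- profiles, not merely the answer. The closure is needed because a partial vote must be transitive,
-- whereas the relation of pairs that cannot be inverted is only known to be acyclic. The main
-- obstacle is time: `PolyTime` asks for a concrete program in a language with a single variable.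
-- Programs are therefore assembled by combinators on `Poly`, which carry a program and a polynomial
-- bound along with a function on trees; that these functions compute the intended constructions is
-- proved separately, on codes. The restriction on accumulators is essential: polynomial time per
-- round does not suffice, since an accumulator that doubles in every round grows exponentially.

infixl 6 _⊕_
infixl 7 _⊗_

-- Polynomial bounds

data Polynomial : Set where
  var     : Polynomial
  const   : ℕ → Polynomial
  _⊕_ _⊗_ : Polynomial → Polynomial → Polynomial

eval : Polynomial → ℕ → ℕ
eval var       n = n
eval (const c) n = c
eval (p ⊕ q)   n = eval p n + eval q n
eval (p ⊗ q)   n = eval p n * eval q n

eval-mono : ∀ p {m n} → m ≤ n → eval p m ≤ eval p n
eval-mono var       m≤n = m≤n
eval-mono (const c) m≤n = ≤-refl
eval-mono (p ⊕ q)   m≤n = +-mono-≤ (eval-mono p m≤n) (eval-mono q m≤n)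
eval-mono (p ⊗ q)   m≤n = *-mono-≤ (eval-mono p m≤n) (eval-mono q m≤n)

_[_] : Polynomial → Polynomial → Polynomial
var     [ r ] = r
const c [ r ] = const c
(p ⊕ q) [ r ] = p [ r ] ⊕ q [ r ]
(p ⊗ q) [ r ] = p [ r ] ⊗ q [ r ]

eval-[] : ∀ p r n → eval (p [ r ]) n ≡ eval p (eval r n)
eval-[] var       r n = refl
eval-[] (const c) r n = refl
eval-[] (p ⊕ q)   r n = cong₂ _+_ (eval-[] p r n) (eval-[] q r n)
eval-[] (p ⊗ q)   r n = cong₂ _*_ (eval-[] p r n) (eval-[] q r n)

-- One number serves as coefficient and as exponent, like the single k in `PolyTime`. Hence a
-- constant counts as itself, and a product needs the product of both numbers as coefficient and
-- their sum as exponent; adding the two covers both.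
degree : Polynomial → ℕ
degree var       = 1
degree (const c) = c
degree (p ⊕ q)   = degree p + degree q
degree (p ⊗ q)   = degree p * degree q + (degree p + degree q)

eval≤power : ∀ p n .{{_ : NonZero n}} → eval p n ≤ degree p * n ^ degree p
eval≤power var n = ≤-reflexive (sym (trans (*-identityˡ (n ^ 1)) (*-identityʳ n)))
eval≤power (const c) n = m≤m*n c (n ^ c) {{m^n≢0 n c}}
eval≤power (p ⊕ q) n = begin
  eval p n + eval q n                 ≤⟨ +-mono-≤ (eval≤power p n) (eval≤power q n) ⟩
  d * n ^ d + e * n ^ e               ≤⟨ +-mono-≤ (*-monoʳ-≤ d (^-monoʳ-≤ n (m≤m+n d e))) (*-monoʳ-≤ e (^-monoʳ-≤ n (m≤n+m e d))) ⟩
  d * n ^ (d + e) + e * n ^ (d + e)   ≡⟨ *-distribʳ-+ (n ^ (d + e)) d e ⟨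
  (d + e) * n ^ (d + e)               ∎
  where
  open ≤-Reasoning
  d = degree p
  e = degree q
eval≤power (p ⊗ q) n = begin
  eval p n * eval q n                        ≤⟨ *-mono-≤ (eval≤power p n) (eval≤power q n) ⟩
  (d * n ^ d) * (e * n ^ e)                  ≡⟨ solve 4 (λ a b c f → (a :* b) :* (c :* f) := (a :* c) :* (b :* f)) refl d (n ^ d) e (n ^ e) ⟩
  (d * e) * (n ^ d * n ^ e)                  ≡⟨ cong (d * e *_) (^-distribˡ-+-* n d e) ⟨
  (d * e) * n ^ (d + e)                      ≤⟨ *-mono-≤ (m≤m+n (d * e) (d + e)) (^-monoʳ-≤ n (m≤n+m (d + e) (d * e))) ⟩
  (d * e + (d + e)) * n ^ (d * e + (d + e))  ∎
  where
  open ≤-Reasoning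
  d = degree p
  e = degree q

-- Running a program on one component of a pair

size≥1 : ∀ x → 1 ≤ size x
size≥1 nil     = s≤s z≤n
size≥1 (_ ∙ _) = s≤s z≤n

size-head : ∀ x → size (head x) ≤ size x
size-head nil     = ≤-refl
size-head (s ∙ t) = m≤n⇒m≤1+n (m≤m+n (size s) (size t))

size-tail : ∀ x → size (tail x) ≤ size x
size-tail nil     = ≤-refl
size-tail (s ∙ t) = m≤n⇒m≤1+n (m≤n+m (size t) (size s))

onHead : Expr → Expr
onHead X          = hd X
onHead nil        = nil
onHead (cons e f) = cons (onHead e) (onHead f)
onHead (hd e)     = hd (onHead e)
onHead (tl e)     = tl (onHead e)

⟦onHead⟧ : ∀ e x c → ⟦ onHead e ⟧ (x ∙ c) ≡ ⟦ e ⟧ x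
⟦onHead⟧ X          x c = refl
⟦onHead⟧ nil        x c = refl
⟦onHead⟧ (cons e f) x c = cong₂ _∙_ (⟦onHead⟧ e x c) (⟦onHead⟧ f x c)
⟦onHead⟧ (hd e)     x c = cong head (⟦onHead⟧ e x c)
⟦onHead⟧ (tl e)     x c = cong tail (⟦onHead⟧ e x c)

-- With a single variable, data that must survive a computation have to be stored next to its input:
-- `P` works on the head while the tail is preserved.
frame : Program → Program
frame (X≔ e)               = X≔ cons (onHead e) (tl X)
frame (P ⨾ Q)              = frame P ⨾ frame Q
frame (if e then P else Q) = if onHead e then frame P else frame Q
frame (while e loop P)     = while onHead e loop frame P

assign-≡ : ∀ {e x y} → ⟦ e ⟧ x ≡ y → X≔ e ⊢ x ⇓ y ⟨ size x + size y ⟩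
assign-≡ refl = assign

-- Every step costs at least one unit, so carrying c along slows a program
-- down by a factor that depends only on the size of c.

slowdown : Tree → ℕ
slowdown c = 3 + 2 * size c

private
  slowdown-start : ∀ x c → size (x ∙ c) ≤ size x * slowdown c
  slowdown-start x c = begin
    suc (size x + size c)                        ≤⟨ m≤m+n _ (1 + size c) ⟩
    suc (size x + size c) + (1 + size c)         ≡⟨ solve 2 (λ a b → con 1 :+ (a :+ b) :+ (con 1 :+ b) := a :+ con 1 :* (con 2 :+ con 2 :* b)) refl (size x) (size c) ⟩
    size x + 1 * (2 + 2 * size c)                ≤⟨ +-monoʳ-≤ (size x) (*-monoˡ-≤ (2 + 2 * size c) (size≥1 x)) ⟩
    size x + size x * (2 + 2 * size c)           ≡⟨ *-suc (size x) (2 + 2 * size c) ⟨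
    size x * slowdown c                          ∎
    where open ≤-Reasoning

frame-runs : ∀ {P x y t} c → P ⊢ x ⇓ y ⟨ t ⟩ →
  ∃[ u ] frame P ⊢ x ∙ c ⇓ y ∙ c ⟨ u ⟩ × u ≤ t * slowdown c
frame-runs c (assign {e} {x}) =
  _ , assign-≡ (cong (_∙ c) (⟦onHead⟧ e x c)) ,
  ≤-trans (+-mono-≤ (slowdown-start x c) (slowdown-start (⟦ e ⟧ x) c))
          (≤-reflexive (sym (*-distribʳ-+ (slowdown c) (size x) (size (⟦ e ⟧ x)))))
frame-runs c (seq {s = s} {t} p q) with frame-runs c p | frame-runs c q
... | _ , p′ , u≤ | _ , q′ , v≤ =
  _ , seq p′ q′ ,
  ≤-trans (+-mono-≤ u≤ v≤) (≤-reflexive (sym (*-distribʳ-+ (slowdown c) s t)))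
frame-runs c (if-true {e} {x = x} {t = t} b p) with frame-runs c p
... | _ , p′ , u≤ =
  _ , if-true (λ eq → b (trans (sym (⟦onHead⟧ e x c)) eq)) p′ ,
  ≤-trans (+-mono-≤ (slowdown-start x c) u≤)
          (≤-reflexive (sym (*-distribʳ-+ (slowdown c) (size x) t)))
frame-runs c (if-false {e} {x = x} {t = t} b p) with frame-runs c p
... | _ , p′ , u≤ =
  _ , if-false (trans (⟦onHead⟧ e x c) b) p′ ,
  ≤-trans (+-mono-≤ (slowdown-start x c) u≤)
          (≤-reflexive (sym (*-distribʳ-+ (slowdown c) (size x) t)))
frame-runs c (while-stop {e} {x = x} b) =
  _ , while-stop (trans (⟦onHead⟧ e x c) b) , slowdown-start x c
frame-runs c (while-step {e} {x = x} {s = s} {t} b p q) with frame-runs c p | frame-runs c q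
... | _ , p′ , u≤ | _ , q′ , v≤ =
  _ , while-step (λ eq → b (trans (sym (⟦onHead⟧ e x c)) eq)) p′ q′ ,
  ≤-trans (+-mono-≤ (slowdown-start x c) (+-mono-≤ u≤ v≤))
          (≤-reflexive (solve 4 (λ a b d k → a :* k :+ (b :* k :+ d :* k) := (a :+ (b :+ d)) :* k) refl (size x) s t (slowdown c)))

-- The last assignment or loop test is charged for the tree it leaves behind. Time bounds thus bound
-- the input of the next program, which lets them be composed.
size≤time : ∀ {P x y t} → P ⊢ x ⇓ y ⟨ t ⟩ → size y ≤ t
size≤time assign            = m≤n+m _ _
size≤time (seq p q)         = ≤-trans (size≤time q) (m≤n+m _ _)
size≤time (if-true _ p)     = ≤-trans (size≤time p) (m≤n+m _ _)
size≤time (if-false _ p)    = ≤-trans (size≤time p) (m≤n+m _ _)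
size≤time (while-stop _)    = ≤-refl
size≤time (while-step {x = x} {s = s} _ p q) =
  ≤-trans (size≤time q) (≤-trans (m≤n+m _ s) (m≤n+m _ (size x)))

-- Polynomial-time functions on trees

record Poly (f : Tree → Tree) : Set where
  constructor poly
  field
    program : Program
    bound   : Polynomial
    runs    : ∀ x → ∃[ t ] program ⊢ x ⇓ f x ⟨ t ⟩ × t ≤ eval bound (size x)

open Poly

Poly-resp : ∀ {f g} → (∀ x → f x ≡ g x) → Poly f → Poly g
Poly-resp f≗g F = poly (program F) (bound F) λ x →
  subst (λ y → ∃[ t ] program F ⊢ x ⇓ y ⟨ t ⟩ × t ≤ eval (bound F) (size x)) (f≗g x) (runs F x)

size≤bound : ∀ {f} (F : Poly f) x → size (f x) ≤ eval (bound F) (size x)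
size≤bound F x with runs F x
... | _ , r , t≤ = ≤-trans (size≤time r) t≤

exprBound : Expr → Polynomial
exprBound X          = var
exprBound nil        = const 1
exprBound (cons e f) = const 1 ⊕ (exprBound e ⊕ exprBound f)
exprBound (hd e)     = exprBound e
exprBound (tl e)     = exprBound e

size-⟦⟧ : ∀ e x → size (⟦ e ⟧ x) ≤ eval (exprBound e) (size x)
size-⟦⟧ X          x = ≤-refl
size-⟦⟧ nil        x = ≤-refl
size-⟦⟧ (cons e f) x = s≤s (+-mono-≤ (size-⟦⟧ e x) (size-⟦⟧ f x))
size-⟦⟧ (hd e)     x = ≤-trans (size-head (⟦ e ⟧ x)) (size-⟦⟧ e x)
size-⟦⟧ (tl e)     x = ≤-trans (size-tail (⟦ e ⟧ x)) (size-⟦⟧ e x)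

expr : ∀ e → Poly ⟦ e ⟧
expr e = poly (X≔ e) (var ⊕ exprBound e) λ x → _ , assign , +-monoʳ-≤ (size x) (size-⟦⟧ e x)

infixr 9 _⊚_

_⊚_ : ∀ {f g} → Poly g → Poly f → Poly (g ∘ f)
_⊚_ {f} G F = poly (program F ⨾ program G) (bound F ⊕ bound G [ bound F ]) time
  where
  time : ∀ x → _
  time x with runs F x | runs G (f x)
  ... | _ , r , s≤ | _ , r′ , t≤ = _ , seq r r′ , +-mono-≤ s≤ (≤-trans t≤ (≤-trans
    (eval-mono (bound G) (size≤bound F x)) (≤-reflexive (sym (eval-[] (bound G) (bound F) (size x))))))

onHeadᴾ : ∀ {f} → Poly f → Poly (λ x → f (head x) ∙ tail x)
-- The assignment turns `nil` into `nil ∙ nil` and changes nothing else, so the framed program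
-- always starts on a pair.
onHeadᴾ {f} F = poly (X≔ cons (hd X) (tl X) ⨾ frame (program F))
                     (bound pairing ⊕ bound F ⊗ (const 3 ⊕ const 2 ⊗ var)) time
  where
  pairing : Poly ⟦ cons (hd X) (tl X) ⟧
  pairing = expr (cons (hd X) (tl X))

  time : ∀ x → _
  time x with runs pairing x | runs F (head x)
  ... | _ , r , s≤ | _ , r′ , t≤ with frame-runs (tail x) r′
  ... | _ , r″ , u≤ = _ , seq r r″ , +-mono-≤ s≤ (≤-trans u≤
    (*-mono-≤ (≤-trans t≤ (eval-mono (bound F) (size-head x)))
              (+-monoʳ-≤ 3 (*-monoʳ-≤ 2 (size-tail x)))))

swap : Expr
swap = cons (tl X) (hd X)

infixr 5 _∙ᴾ_

_∙ᴾ_ : ∀ {f g} → Poly f → Poly g → Poly (λ x → f x ∙ g x)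
-- From right to left, x becomes `x ∙ x`, `f x ∙ x`, `x ∙ f x`, `g x ∙ f x` and `f x ∙ g x`.
F ∙ᴾ G = expr swap ⊚ onHeadᴾ G ⊚ expr swap ⊚ onHeadᴾ F ⊚ expr (cons X X)

cond : Tree → Tree → Tree → Tree
cond nil     y z = z
cond (_ ∙ _) y z = y

caseᴾ : ∀ {f g} → Poly f → Poly g → Poly (λ x → cond (head x) (f x) (g x))
caseᴾ {f} {g} F G = poly (if hd X then program F else program G)
                         (var ⊕ (bound F ⊕ bound G)) time
  where
  time : ∀ x → ∃[ t ] if hd X then program F else program G ⊢ x ⇓ cond (head x) (f x) (g x) ⟨ t ⟩
                      × t ≤ eval (var ⊕ (bound F ⊕ bound G)) (size x)
  time x with head x in eq
  time x | nil with runs G x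
  ... | _ , r , t≤ = _ , if-false eq r , +-monoʳ-≤ (size x) (≤-trans t≤ (m≤n+m _ _))
  time x | _ ∙ _ with runs F x
  ... | _ , r , t≤ = _ , if-true (λ eq′ → case (trans (sym eq) eq′)) r ,
                     +-monoʳ-≤ (size x) (≤-trans t≤ (m≤m+n _ _))
    where
    case : ∀ {s t} → s ∙ t ≢ nil
    case ()

condᴾ : ∀ {b f g} → Poly b → Poly f → Poly g → Poly (λ x → cond (b x) (f x) (g x))
condᴾ B F G = caseᴾ (F ⊚ expr (tl X)) (G ⊚ expr (tl X)) ⊚ (B ∙ᴾ expr X)

-- Bound variables are consed onto the input: hd X is the innermost one,
-- hd (tl X) the next one.

infix 0 letᴾ_inᴾ_

letᴾ_inᴾ_ : ∀ {f g} → Poly f → Poly g → Poly (λ x → g (f x ∙ x))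
letᴾ F inᴾ G = G ⊚ (F ∙ᴾ expr X)

-- Loops

fold : (Tree → Tree → Tree) → Tree → Tree → Tree
fold g acc nil     = acc
fold g acc (a ∙ l) = fold g (g a acc) l

-- A loop runs in polynomial time when each round adds to the accumulator
-- an amount that is bounded independently of the accumulator.

Growth : (Tree → Tree) → Polynomial → Set
Growth g q = ∀ a acc x → size (g (a ∙ acc ∙ x)) ≤ size acc + eval q (size a + size x)

-- The state of a loop is `l ∙ acc ∙ x`: the rest of the list, the accumulator, and the original
-- input, kept as environment for the body.
Round : (Tree → Tree) → Tree → Tree
Round g s = tail (head s) ∙ g (head (head s) ∙ tail s) ∙ tail (tail s)

module _ {g} (round : Poly (Round g)) (q : Polynomial) (growth : Growth g q) where

  private
    loop : Program
    loop = while hd X loop program round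

    iterate : Tree → Tree → Tree → Tree
    iterate x = fold (λ a acc → g (a ∙ acc ∙ x))

    Looped : Tree → Tree → Tree → ℕ → Set
    Looped l acc x u = ∃[ t ] loop ⊢ l ∙ acc ∙ x ⇓ nil ∙ iterate x acc l ∙ x ⟨ t ⟩ × t ≤ u

    loop-step : ∀ a l acc x B → size ((a ∙ l) ∙ acc ∙ x) ≤ B →
      Looped l (g (a ∙ acc ∙ x)) x (size l * (B + eval (bound round) B)) →
      Looped (a ∙ l) acc x (size (a ∙ l) * (B + eval (bound round) B))
    loop-step a l acc x B now≤B (t , r′ , t≤) with runs round ((a ∙ l) ∙ acc ∙ x)
    ... | s , r , s≤ = _ , while-step (λ ()) r r′ , (begin
        size ((a ∙ l) ∙ acc ∙ x) + (s + t)  ≤⟨ +-mono-≤ now≤B (+-mono-≤ (≤-trans s≤ (eval-mono (bound round) now≤B)) t≤) ⟩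
        B + (R + size l * (B + R))          ≡⟨ +-assoc B R _ ⟨
        suc (size l) * (B + R)              ≤⟨ *-monoˡ-≤ (B + R) (s≤s (m≤n+m (size l) (size a))) ⟩
        size (a ∙ l) * (B + R)              ∎)
      where
      open ≤-Reasoning
      R = eval (bound round) B

    -- `B` bounds the current state together with a reserve of `eval q N` for each unit of size of
    -- the remaining list. The growth of the accumulator is paid from this reserve, so the same `B`
    -- bounds all later states, and each round costs at most `B` for the test and
    -- `eval (bound round) B` for the body.
    loop-runs : ∀ l acc x N B → size l + size x ≤ N →
      size (l ∙ acc ∙ x) + size l * eval q N ≤ B →
      Looped l acc x (size l * (B + eval (bound round) B))
    loop-runs nil acc x N B _ ≤B = _ , while-stop refl ,
      ≤-trans (m+n≤o⇒m≤o _ ≤B) (≤-trans (m≤m+n B _) (m≤m+n _ 0))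
    loop-runs (a ∙ l) acc x N B ≤N ≤B = loop-step a l acc x B (m+n≤o⇒m≤o _ ≤B)
      (loop-runs l (g (a ∙ acc ∙ x)) x N B (≤-trans (+-monoˡ-≤ (size x) l≤) ≤N) ≤B′)
      where
      open ≤-Reasoning
      Q  = eval q N
      l≤ : size l ≤ size (a ∙ l)
      l≤ = m≤n⇒m≤1+n (m≤n+m (size l) (size a))
      a≤ : size a ≤ size (a ∙ l)
      a≤ = m≤n⇒m≤1+n (m≤m+n (size a) (size l))
      acc′≤ : size (g (a ∙ acc ∙ x)) ≤ size acc + Q
      acc′≤ = ≤-trans (growth a acc x)
        (+-monoʳ-≤ (size acc) (eval-mono q (≤-trans (+-monoˡ-≤ (size x) a≤) ≤N)))
      ≤B′ : size (l ∙ g (a ∙ acc ∙ x) ∙ x) + size l * Q ≤ B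
      ≤B′ = begin
        size (l ∙ g (a ∙ acc ∙ x) ∙ x) + size l * Q
          ≤⟨ +-monoˡ-≤ (size l * Q) (s≤s (+-monoʳ-≤ (size l) (s≤s (+-monoˡ-≤ (size x) acc′≤)))) ⟩
        suc (size l + suc (size acc + Q + size x)) + size l * Q
          -- Consuming `a` frees `1 + size a` in the state and `(1 + size a) * Q` of the reserve.
          -- One `Q` pays for the new accumulator; this is the rest.
          ≤⟨ m≤m+n _ (1 + size a + size a * Q) ⟩
        suc (size l + suc (size acc + Q + size x)) + size l * Q + (1 + size a + size a * Q)
          ≡⟨ solve 5 (λ a l c q x → con 1 :+ (l :+ (con 1 :+ (c :+ q :+ x))) :+ l :* q :+ (con 1 :+ a :+ a :* q)
                := con 1 :+ (con 1 :+ (a :+ l) :+ (con 1 :+ (c :+ x))) :+ (con 1 :+ (a :+ l)) :* q)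
               refl (size a) (size l) (size acc) Q (size x) ⟩
        size ((a ∙ l) ∙ acc ∙ x) + size (a ∙ l) * Q
          ≤⟨ ≤B ⟩
        B ∎

    loopTime : Polynomial
    loopTime = var ⊗ (B ⊕ bound round [ B ])
      where
      B : Polynomial
      B = var ⊕ var ⊗ q

    loop-time : ∀ l acc x → Looped l acc x (eval loopTime (size (l ∙ acc ∙ x)))
    loop-time l acc x with loop-runs l acc x n (n + n * eval q n)
         (≤-trans (+-monoʳ-≤ (size l) (m≤n⇒m≤1+n (m≤n+m (size x) (size acc)))) (m≤n+m _ 1))
         (+-monoʳ-≤ n (*-monoˡ-≤ (eval q n) l≤n))
      where
      n = size (l ∙ acc ∙ x)
      l≤n : size l ≤ n
      l≤n = m≤n⇒m≤1+n (m≤m+n (size l) _)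
    ... | t , r , t≤ = t , r , ≤-trans t≤ (*-mono-≤ (m≤n⇒m≤1+n (m≤m+n (size l) _))
            (+-monoʳ-≤ _ (≤-reflexive (sym (eval-[] (bound round) (var ⊕ var ⊗ q) _)))))

  loopᴾ : ∀ (i l : Tree → Tree) → Poly (λ x → l x ∙ i x ∙ x) →
    Poly (λ x → nil ∙ fold (λ a acc → g (a ∙ acc ∙ x)) (i x) (l x) ∙ x)
  loopᴾ i l start = poly (program start ⨾ loop) (bound start ⊕ loopTime [ bound start ]) time
    where
    time : ∀ x → ∃[ t ] program start ⨾ loop ⊢ x ⇓ nil ∙ iterate x (i x) (l x) ∙ x ⟨ t ⟩
                        × t ≤ eval (bound start ⊕ loopTime [ bound start ]) (size x)
    time x with runs start x | loop-time (l x) (i x) x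
    ... | _ , r , s≤ | _ , r′ , t≤ = _ , seq r r′ , +-mono-≤ s≤ (≤-trans t≤ (≤-trans
      (eval-mono loopTime (size≤bound start x)) (≤-reflexive (sym (eval-[] loopTime (bound start) (size x))))))

foldᴾ : ∀ {g i l} → Poly g → (q : Polynomial) → Growth g q → Poly i → Poly l →
  Poly (λ x → fold (λ a acc → g (a ∙ acc ∙ x)) (i x) (l x))
foldᴾ {g} {i} {l} G q growth I L = expr (hd (tl X)) ⊚ loopᴾ {g} round q growth i l (L ∙ᴾ I ∙ᴾ expr X)
  where
  round : Poly (Round g)
  round = expr (tl (hd X)) ∙ᴾ (G ⊚ expr (cons (hd (hd X)) (tl X))) ∙ᴾ expr (tl (tl X))

-- Lists, unary numbers and truth values

trueᵀ : Tree
trueᵀ = nil ∙ nil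

drop : Tree → Tree → Tree
drop n l = fold (λ _ acc → tail acc) l n

dropᴾ : ∀ {n l} → Poly n → Poly l → Poly (λ x → drop (n x) (l x))
dropᴾ N L = foldᴾ (expr (tl (hd (tl X)))) (const 0)
  (λ _ acc _ → ≤-trans (size-tail acc) (m≤m+n (size acc) 0)) L N

nth : Tree → Tree → Tree
nth n l = head (drop n l)

nthᴾ : ∀ {n l} → Poly n → Poly l → Poly (λ x → nth (n x) (l x))
nthᴾ N L = expr (hd X) ⊚ dropᴾ N L

-- A unary number is a list of that length: i is less than j exactly when dropping i entries from j
-- leaves something.
lt : Tree → Tree → Tree
lt i j = cond (drop i j) trueᵀ nil

ltᴾ : ∀ {i j} → Poly i → Poly j → Poly (λ x → lt (i x) (j x))
ltᴾ I J = condᴾ (dropᴾ I J) (expr (cons nil nil)) (expr nil)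

map : (Tree → Tree) → Tree → Tree
map h nil     = nil
map h (a ∙ l) = h a ∙ map h l

private
  reverse : Tree → Tree → Tree
  reverse = fold λ a acc → a ∙ acc

  mapOnto : (Tree → Tree) → Tree → Tree → Tree
  mapOnto h r nil     = r
  mapOnto h r (a ∙ l) = h a ∙ mapOnto h r l

  reverse-fold : ∀ h acc r l →
    reverse r (fold (λ a acc → h a ∙ acc) acc l) ≡ reverse (mapOnto h r l) acc
  reverse-fold h acc r nil     = refl
  reverse-fold h acc r (a ∙ l) = reverse-fold h (h a ∙ acc) r l

  mapOnto-nil : ∀ h l → mapOnto h nil l ≡ map h l
  mapOnto-nil h nil     = refl
  mapOnto-nil h (a ∙ l) = cong (h a ∙_) (mapOnto-nil h l)

  shift-growth : ∀ a c {q} → a ≤ q → suc (a + c) ≤ c + suc q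
  shift-growth a c {q} a≤q = ≤-trans (s≤s (≤-trans (≤-reflexive (+-comm a c)) (+-monoʳ-≤ c a≤q)))
                                     (≤-reflexive (sym (+-suc c q)))

mapᴾ : ∀ {h l} → Poly h → Poly l → Poly (λ x → map (λ a → h (a ∙ x)) (l x))
-- The inner fold reads the list from the front and so builds the result backwards; the outer one
-- reverses it.
mapᴾ {h} {l} H L = Poly-resp
  (λ x → trans (reverse-fold (λ a → h (a ∙ x)) nil nil (l x)) (mapOnto-nil (λ a → h (a ∙ x)) (l x)))
  (foldᴾ (expr (cons (hd X) (hd (tl X)))) (const 1 ⊕ var)
    (λ a acc x → shift-growth (size a) (size acc) (m≤m+n (size a) (size x)))
    (expr nil)
    (foldᴾ (H ⊚ expr (cons (hd X) (tl (tl X))) ∙ᴾ expr (hd (tl X))) (const 1 ⊕ bound H [ const 1 ⊕ var ])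
      (λ a acc x → shift-growth (size (h (a ∙ x))) (size acc)
        (≤-trans (size≤bound H (a ∙ x)) (≤-reflexive (sym (eval-[] (bound H) (const 1 ⊕ var) (size a + size x))))))
      (expr nil) L))

size-map : ∀ h l B → (∀ a → size (h a) ≤ B) → size (map h l) ≤ suc B * size l
size-map h nil     B ≤B = s≤s z≤n
size-map h (a ∙ l) B ≤B = begin
  suc (size (h a) + size (map h l))  ≤⟨ s≤s (+-mono-≤ (≤B a) (size-map h l B ≤B)) ⟩
  suc B + suc B * size l             ≡⟨ *-suc (suc B) (size l) ⟨
  suc B * suc (size l)               ≤⟨ *-monoʳ-≤ (suc B) (s≤s (m≤n+m (size l) (size a))) ⟩
  suc B * size (a ∙ l)               ∎
  where open ≤-Reasoning

count : (Tree → Tree) → Tree → Tree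
count h = fold (λ a acc → cond (h a) (nil ∙ acc) acc) nil

countᴾ : ∀ {h l} → Poly h → Poly l → Poly (λ x → count (λ a → h (a ∙ x)) (l x))
countᴾ {h} H L = foldᴾ
  (condᴾ (H ⊚ expr (cons (hd X) (tl (tl X)))) (expr (cons nil (hd (tl X)))) (expr (hd (tl X))))
  (const 2) growth (expr nil) L
  where
  growth : ∀ a acc x → size (cond (h (a ∙ x)) (nil ∙ acc) acc) ≤ size acc + 2
  growth a acc x with h (a ∙ x)
  ... | nil   = m≤m+n (size acc) 2
  ... | _ ∙ _ = ≤-reflexive (+-comm 2 (size acc))

-- The list is built from its last entry; the accumulator, a list of length k,
-- doubles as the unary number k.

indices : Tree → Tree
indices m = fold (λ _ acc → drop acc (tail m) ∙ acc) nil m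

size-drop : ∀ n l → size (drop n l) ≤ size l
size-drop nil     l = ≤-refl
size-drop (_ ∙ n) l = ≤-trans (size-drop n (tail l)) (size-tail l)

indicesᴾ : Poly indices
indicesᴾ = foldᴾ
  (dropᴾ (expr (hd (tl X))) (expr (tl (tl (tl X)))) ∙ᴾ expr (hd (tl X))) (const 1 ⊕ var)
  (λ a acc x → shift-growth (size (drop acc (tail x))) (size acc)
    (≤-trans (size-drop acc (tail x)) (≤-trans (size-tail x) (m≤n+m (size x) (size a)))))
  (expr nil) (expr X)

length : Tree → Tree
length = count (λ _ → trueᵀ)

lengthᴾ : Poly length
lengthᴾ = countᴾ (expr (cons nil nil)) (expr X)

-- Behaviour on codes

codeTable-cong : ∀ {n} {f g : Fin n → Tree} → (∀ i → f i ≡ g i) → codeTable f ≡ codeTable g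
codeTable-cong {zero}  f≗g = refl
codeTable-cong {suc n} f≗g = cong₂ _∙_ (f≗g zero) (codeTable-cong (f≗g ∘ suc))

map-code : ∀ {n} h (f : Fin n → Tree) → map h (codeTable f) ≡ codeTable (h ∘ f)
map-code {zero}  h f = refl
map-code {suc n} h f = cong (h (f zero) ∙_) (map-code h (f ∘ suc))

map-code-≗ : ∀ {n} h (f : Fin n → Tree) {g} → (∀ i → h (f i) ≡ g i) → map h (codeTable f) ≡ codeTable g
map-code-≗ h f h∘f≗g = trans (map-code h f) (codeTable-cong h∘f≗g)

-- Simulation of a fold on states by a fold on their codes. The injection of indices `ι` is general
-- so that the induction can pass to tails of the table.
fold-code : ∀ {n m} {S : Set} (g : Tree → Tree → Tree) (code : S → Tree)
  (f : Fin m → Tree) (ι : Fin n → Fin m) (next : S → Fin m → S) →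
  (∀ i s → g (f i) (code s) ≡ code (next s i)) → ∀ s →
  fold g (code s) (codeTable (f ∘ ι)) ≡ code (List.foldl next s (List.tabulate ι))
fold-code {zero}  g code f ι next sim s = refl
fold-code {suc n} g code f ι next sim s =
  trans (cong (λ acc → fold g acc (codeTable (f ∘ ι ∘ suc))) (sim (ι zero) s))
        (fold-code g code f (ι ∘ suc) next sim (next s (ι zero)))

nth-code : ∀ {n} (f : Fin n → Tree) i → nth (codeFin i) (codeTable f) ≡ f i
nth-code {suc n} f zero    = refl
nth-code {suc n} f (suc i) = nth-code (f ∘ suc) i

drop-nil : ∀ n → drop n nil ≡ nil
drop-nil nil     = refl
drop-nil (_ ∙ n) = drop-nil n

lt-code : ∀ i j → lt (codeUnary i) (codeUnary j) ≡ codeBool (i <ᵇ j)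
lt-code zero    zero    = refl
lt-code zero    (suc j) = refl
lt-code (suc i) zero    = cong (λ t → cond t trueᵀ nil) (drop-nil (codeUnary i))
lt-code (suc i) (suc j) = lt-code i j

∨-code : ∀ b c → cond (codeBool b) trueᵀ (codeBool c) ≡ codeBool (b ∨ c)
∨-code false c = refl
∨-code true  c = refl

∧-code : ∀ b c → cond (codeBool b) (codeBool c) nil ≡ codeBool (b ∧ c)
∧-code false c = refl
∧-code true  c = refl

count-code : ∀ {n} h (f : Fin n → Tree) (p : Fin n → Bool) → (∀ i → h (f i) ≡ codeBool (p i)) →
  count h (codeTable f) ≡ codeUnary ∣ tabulate p ∣
count-code h f p h∘f≗p = trans (go f p h∘f≗p 0) (cong codeUnary (+-identityʳ _))
  where
  go : ∀ {n} (f : Fin n → Tree) (p : Fin n → Bool) → (∀ i → h (f i) ≡ codeBool (p i)) → ∀ k →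
    fold (λ a acc → cond (h a) (nil ∙ acc) acc) (codeUnary k) (codeTable f) ≡
    codeUnary (∣ tabulate p ∣ + k)
  go {zero}  f p h∘f≗p k = refl
  go {suc n} f p h∘f≗p k rewrite h∘f≗p zero with p zero
  ... | false = go (f ∘ suc) (p ∘ suc) (h∘f≗p ∘ suc) k
  ... | true  = trans (go (f ∘ suc) (p ∘ suc) (h∘f≗p ∘ suc) (suc k))
                      (cong codeUnary (+-suc ∣ tabulate (p ∘ suc) ∣ k))

length-code : ∀ {n} (f : Fin n → Tree) → length (codeTable f) ≡ codeUnary n
length-code {n} f = trans (go f 0) (cong codeUnary (+-identityʳ n))
  where
  go : ∀ {n} (f : Fin n → Tree) k →
    fold (λ a acc → nil ∙ acc) (codeUnary k) (codeTable f) ≡ codeUnary (n + k)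
  go {zero}  f k = refl
  go {suc n} f k = trans (go (f ∘ suc) (suc k)) (cong codeUnary (+-suc n k))

indices-code : ∀ m → indices (codeUnary m) ≡ codeTable {m} codeFin
indices-code m = trans (go m 0 m (+-identityʳ m)) (interval-code 0 m)
  where
  interval : ℕ → ℕ → Tree
  interval j zero    = nil
  interval j (suc r) = codeUnary j ∙ interval (suc j) r

  interval-code : ∀ j r → interval j r ≡ codeTable {r} (λ i → codeUnary (j + toℕ i))
  interval-code j zero    = refl
  interval-code j (suc r) = cong₂ _∙_ (cong codeUnary (sym (+-identityʳ j)))
    (trans (interval-code (suc j) r)
           (codeTable-cong {r} λ i → cong codeUnary (sym (+-suc j (toℕ i)))))

  drop-interval : ∀ j k r → drop (interval k r) (codeUnary (j + r)) ≡ codeUnary j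
  drop-interval j k zero    = cong codeUnary (+-identityʳ j)
  drop-interval j k (suc r) rewrite +-suc j r = drop-interval j (suc k) r

  -- With j rounds left, the accumulator lists j, ..., m - 1 and has length r. Dropping r entries
  -- from m - 1 gives j - 1, the next entry to prepend.
  go : ∀ j r m → j + r ≡ m →
    fold (λ _ acc → drop acc (tail (codeUnary m)) ∙ acc) (interval j r) (codeUnary j) ≡ interval 0 m
  go zero    r _ refl = refl
  go (suc j) r _ refl rewrite drop-interval j (suc j) r = go j (suc r) (suc j + r) (+-suc j r)

-- Strict inclusion and cardinality; votes as bijections

∣tabulate∣-mono-< : ∀ {n} (p q : Fin n → Bool) → (∀ i → T (p i) → T (q i)) →
  ∀ i → T (q i) → ¬ T (p i) → ∣ tabulate p ∣ ℕ.< ∣ tabulate q ∣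
∣tabulate∣-mono-< p q p⇒q i qi ¬pi = p⊂q⇒∣p∣<∣q∣
  ((λ {j} j∈p → T⇒∈ q (p⇒q j (∈⇒T p j∈p))) , i , T⇒∈ q qi , ¬pi ∘ ∈⇒T p)
  where
  T⇒∈ : ∀ {n} (p : Fin n → Bool) {i} → T (p i) → i ∈ tabulate p
  T⇒∈ p {i} pi = lookup⇒[]= i _ (trans (lookup∘tabulate p i) (to T-≡ pi))
  ∈⇒T : ∀ {n} (p : Fin n → Bool) {i} → i ∈ tabulate p → T (p i)
  ∈⇒T p {i} i∈p = from T-≡ (trans (sym (lookup∘tabulate p i)) ([]=⇒lookup i∈p))

pos : ∀ {m} → Vote m → Fin m → ℕ
pos v c = toℕ (rank v c)

pos-injective : ∀ {m} (v : Vote m) {a b} → pos v a ≡ pos v b → a ≡ b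
-- The proof `inj` is irrelevant; decidable equality makes its conclusion usable.
pos-injective (mkVote _ inj) {a} {b} eq = recompute (a ≟ b) (inj (toℕ-injective eq))

-- Pigeonhole: punching out a missed value would inject `suc m` elements into `m`.
injective⇒surjective : ∀ {m} (f : Fin m → Fin m) → (∀ {a b} → f a ≡ f b → a ≡ b) →
  ∀ r → ∃[ c ] f c ≡ r
injective⇒surjective {suc m} f inj r with any? (λ c → f c ≟ r)
... | yes found = found
... | no ¬found = contradiction
  (injective⇒≤ {f = λ c → punchOut (r≢f c)} (λ {a} {b} eq → inj (punchOut-injective (r≢f a) (r≢f b) eq)))
  1+n≰n
  where
  r≢f : ∀ c → r ≢ f c
  r≢f c r≡fc = ¬found (c , sym r≡fc)

pos-surjective : ∀ {m} (v : Vote m) {k} → k ℕ.< m → ∃[ c ] pos v c ≡ k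
pos-surjective v k<m with injective⇒surjective (rank v) (pos-injective v ∘ cong toℕ) (fromℕ< k<m)
... | c , eq = c , trans (cong toℕ eq) (toℕ-fromℕ< k<m)

Vote-≡ : ∀ {m} {v w : Vote m} → (∀ c → pos v c ≡ pos w c) → v ≡ w
Vote-≡ {v = v} {w} eq = ranks-≡ (trans (sym (tabulate∘lookup (ranks v)))
  (trans (tabulate-cong (toℕ-injective ∘ eq)) (tabulate∘lookup (ranks w))))
  where
  ranks-≡ : ∀ {m} {v w : Vote m} → ranks v ≡ ranks w → v ≡ w
  ranks-≡ refl = refl

-- A vote w that increases along every step of u is squeezed against u from
-- both ends of the ranking.

increasing⇒≡ : ∀ {m} (u w : Vote m) →
  (∀ a b → suc (pos u a) ≡ pos u b → pos w a ℕ.< pos w b) → u ≡ w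
increasing⇒≡ {m} u w incr = Vote-≡ λ c → ≤-antisym (lower (pos u c) c refl) (≤pos c)
  where
  lower : ∀ k c → pos u c ≡ k → k ≤ pos w c
  lower zero    c eq = z≤n
  lower (suc k) c eq with pos-surjective u (<-trans (n<1+n k) (subst (ℕ._< m) eq (toℕ<n (rank u c))))
  ... | d , d≡k = ≤-<-trans (lower k d d≡k) (incr d c (trans (cong suc d≡k) (sym eq)))

  -- Here k is the number of candidates below `c` in `u`; the `suc` accounts for positions ending at
  -- m - 1.
  upper : ∀ k c → pos u c + suc k ≡ m → pos w c + suc k ≤ m
  upper zero    c eq = subst (_≤ m) (+-comm 1 (pos w c)) (toℕ<n (rank w c))
  upper (suc k) c eq with pos-surjective u {suc (pos u c)}
    (subst (suc (suc (pos u c)) ≤_) (trans (cong suc (sym (+-suc (pos u c) k))) (trans (sym (+-suc (pos u c) (suc k))) eq))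
      (s≤s (s≤s (m≤m+n (pos u c) k))))
  ... | d , d≡ = ≤-trans
    (subst (_≤ pos w d + suc k) (sym (+-suc (pos w c) (suc k))) (+-monoˡ-≤ (suc k) (incr c d (sym d≡))))
    (upper k d (trans (cong (_+ suc k) d≡) (trans (sym (+-suc (pos u c) (suc k))) eq)))

  ≤pos : ∀ c → pos w c ≤ pos u c
  ≤pos c with m≤n⇒∃[o]m+o≡n (toℕ<n (rank u c))
  ... | k , eq = +-cancelʳ-≤ (suc k) _ _ (≤-trans (upper k c eq′) (≤-reflexive (sym eq′)))
    where
    eq′ : pos u c + suc k ≡ m
    eq′ = trans (+-suc (pos u c) k) eq

-- Adjacent swaps

transpose-fst : ∀ {m} (a b : Fin m) → transpose a b a ≡ b
transpose-fst a b with a ≟ a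
... | yes _  = refl
... | no a≢a = contradiction refl a≢a

transpose-snd : ∀ {m} (a b : Fin m) → transpose a b b ≡ a
transpose-snd a b with b ≟ a
... | yes b≡a = b≡a
... | no _ with b ≟ b
...   | yes _  = refl
...   | no b≢b = contradiction refl b≢b

transpose-other : ∀ {m} {a b c : Fin m} → c ≢ a → c ≢ b → transpose a b c ≡ c
transpose-other {a = a} {b} {c} c≢a c≢b with c ≟ a
... | yes c≡a = contradiction c≡a c≢a
... | no _ with c ≟ b
...   | yes c≡b = contradiction c≡b c≢b
...   | no _    = refl

open Swap using (fst; snd)

module _ {m} (v : Vote m) {a b : Fin m} .(a≢b : a ≢ b) where

  private
    v′ : Vote m
    v′ = applySwap (mkSwap a b a≢b) v

    pos-swap : ∀ c → pos v′ c ≡ pos v (transpose a b c)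
    pos-swap c = cong toℕ (lookup∘tabulate _ c)

  swap-fst : pos v′ a ≡ pos v b
  swap-fst = trans (pos-swap a) (cong (pos v) (transpose-fst a b))

  swap-snd : pos v′ b ≡ pos v a
  swap-snd = trans (pos-swap b) (cong (pos v) (transpose-snd a b))

  swap-other : ∀ {c} → c ≢ a → c ≢ b → pos v′ c ≡ pos v c
  swap-other c≢a c≢b = trans (pos-swap _) (cong (pos v) (transpose-other c≢a c≢b))

  -- Since `a` and `b` are adjacent, a third candidate is above both or below both, and exchanging
  -- them does not change that.
  swap-keeps : suc (pos v a) ≡ pos v b → ∀ {x y} → ¬ (x ≡ a × y ≡ b) →
    pos v x ℕ.< pos v y → pos v′ x ℕ.< pos v′ y
  swap-keeps adj {x} {y} xy≢ab x<y with x ≟ a | x ≟ b | y ≟ a | y ≟ b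
  ... | yes refl | _ | yes refl | _ = contradiction x<y (<-irrefl refl)
  ... | yes refl | _ | no _ | yes refl = contradiction (refl , refl) xy≢ab
  ... | yes refl | _ | no y≢a | no y≢b = subst₂ ℕ._<_ (sym swap-fst) (sym (swap-other y≢a y≢b))
    (≤∧≢⇒< (subst (_≤ pos v y) adj x<y) (y≢b ∘ sym ∘ pos-injective v))
  ... | no _ | yes refl | yes refl | _ = contradiction (subst (ℕ._< pos v a) (sym adj) x<y) (<-asym (n<1+n _))
  ... | no _ | yes refl | no _ | yes refl = contradiction x<y (<-irrefl refl)
  ... | no _ | yes refl | no y≢a | no y≢b = subst₂ ℕ._<_ (sym swap-snd) (sym (swap-other y≢a y≢b))
    (<-trans (subst (pos v a ℕ.<_) adj (n<1+n _)) x<y)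
  ... | no x≢a | no x≢b | yes refl | _ = subst₂ ℕ._<_ (sym (swap-other x≢a x≢b)) (sym swap-fst)
    (<-trans x<y (subst (pos v a ℕ.<_) adj (n<1+n _)))
  ... | no x≢a | no x≢b | no _ | yes refl = subst₂ ℕ._<_ (sym (swap-other x≢a x≢b)) (sym swap-snd)
    (≤∧≢⇒< (≤-pred (subst (pos v x ℕ.<_) (sym adj) x<y)) (x≢a ∘ pos-injective v))
  ... | no x≢a | no x≢b | no y≢a | no y≢b =
    subst₂ ℕ._<_ (sym (swap-other x≢a x≢b)) (sym (swap-other y≢a y≢b)) x<y

  swap-reflects : suc (pos v a) ≡ pos v b → ∀ {x y} → ¬ (x ≡ b × y ≡ a) →
    pos v′ x ℕ.< pos v′ y → pos v x ℕ.< pos v y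
  swap-reflects adj {x} {y} xy≢ba x<′y with <-cmp (pos v x) (pos v y)
  ... | tri< x<y _ _ = x<y
  ... | tri≈ _ x≡y _ = contradiction x<′y (<-irrefl (cong (pos v′) (pos-injective v x≡y)))
  ... | tri> _ _ y<x = contradiction x<′y
    (<-asym (swap-keeps adj (λ (y≡a , x≡b) → xy≢ba (x≡b , y≡a)) y<x))

-- While `x` is above `y`, the swap of `x` and `y` in this orientation is the only step that can
-- reverse them.
path-keeps : ∀ {m} {v w : Vote m} {σ} {x y} → v ⟶[ σ ] w →
  All (λ s → ¬ (x ≡ fst s × y ≡ snd s)) σ → pos v x ℕ.< pos v y → pos w x ℕ.< pos w y
path-keeps done [] x<y = x<y
path-keeps {v = v} (step {s = mkSwap _ _ a≢b} adj path) (xy≢s ∷ rest) x<y =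
  path-keeps path rest (swap-keeps v a≢b adj xy≢s x<y)

-- Inversions and sorting

Inverted : ∀ {m} → Vote m → Vote m → Fin m → Fin m → Set
Inverted u w a b = pos u a ℕ.< pos u b × pos w b ℕ.< pos w a

inverted? : ∀ {m} (u w : Vote m) a b → Dec (Inverted u w a b)
inverted? u w a b = (pos u a <? pos u b) ×-dec (pos w b <? pos w a)

-- Pairs are coded in `Fin (m * m)` so that their number is the cardinality of a Boolean vector; it
-- is the termination measure of bubble sort.
inversions : ∀ {m} → Vote m → Vote m → Fin (m * m) → Bool
inversions {m} u w k = isYes (uncurry (inverted? u w) (remQuot m k))

module _ {m} (u w : Vote m) {a b : Fin m} .(a≢b : a ≢ b)
         (adj : suc (pos u a) ≡ pos u b) (b<a : pos w b ℕ.< pos w a) where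

  private
    u′ : Vote m
    u′ = applySwap (mkSwap a b a≢b) u

  swap-uninverts : ¬ Inverted u′ w a b
  swap-uninverts (a<′b , _) = <-asym a<′b
    (subst₂ ℕ._<_ (sym (swap-snd u a≢b)) (trans adj (sym (swap-fst u a≢b))) (n<1+n (pos u a)))

  swap-inverts-no-more : ∀ {x y} → Inverted u′ w x y → Inverted u w x y
  swap-inverts-no-more (x<′y , y<x) =
    swap-reflects u a≢b adj (λ { (refl , refl) → <-asym b<a y<x }) x<′y , y<x

  swap-inversions : ∣ tabulate (inversions u′ w) ∣ ℕ.< ∣ tabulate (inversions u w) ∣
  swap-inversions = ∣tabulate∣-mono-< (inversions u′ w) (inversions u w)
    (λ k → let x , y = remQuot {m} m k in
      fromWitness ∘ swap-inverts-no-more ∘ toWitness {a? = inverted? u′ w x y})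
    (combine a b)
    (subst (T ∘ isYes ∘ uncurry (inverted? u w)) (sym (remQuot-combine a b))
      (fromWitness (≤-reflexive adj , b<a)))
    (swap-uninverts ∘ toWitness ∘ subst (T ∘ isYes ∘ uncurry (inverted? u′ w)) (remQuot-combine a b))

-- Bubble sort: swapping an adjacent inverted pair creates no new inversion, so
-- no pair is swapped twice.

sorting-path : ∀ {m} (u w : Vote m) → ∃[ σ ]
  u ⟶[ σ ] w × All (λ s → Inverted u w (fst s) (snd s)) σ × Unique σ
sorting-path {m} u w = sort u (<-wellFounded _)
  where
  sort : ∀ u → Acc ℕ._<_ ∣ tabulate (inversions u w) ∣ → ∃[ σ ]
    u ⟶[ σ ] w × All (λ s → Inverted u w (fst s) (snd s)) σ × Unique σ
  sort u (WF.acc rec) with any? (λ a → any? (λ b → (suc (pos u a) ℕ.≟ pos u b) ×-dec (pos w b <? pos w a)))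
  ... | no sorted = [] , subst (u ⟶[ [] ]_) (increasing⇒≡ u w incr) done , [] , []
    where
    incr : ∀ a b → suc (pos u a) ≡ pos u b → pos w a ℕ.< pos w b
    incr a b adj = ≤∧≢⇒< (≮⇒≥ λ b<a → sorted (a , b , adj , b<a))
      λ eq → 1+n≢n (trans adj (cong (pos u) (sym (pos-injective w eq))))
  ... | yes (a , b , adj , b<a) = extend (sort u′ (rec (swap-inversions u w a≢b adj b<a)))
    where
    a≢b : a ≢ b
    a≢b a≡b = <-irrefl (cong (pos w) (sym a≡b)) b<a
    u′ : Vote m
    u′ = applySwap (mkSwap a b a≢b) u
    extend : ∃[ σ ] u′ ⟶[ σ ] w × All (λ s → Inverted u′ w (fst s) (snd s)) σ × Unique σ → _
    extend (σ , path , inv , uniq) = mkSwap a b a≢b ∷ σ , step adj path ,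
      (≤-reflexive adj , b<a) ∷ All.map (swap-inverts-no-more u w a≢b adj b<a) inv ,
      All.map (λ { inverted refl → swap-uninverts u w a≢b adj b<a inverted }) inv ∷ uniq

-- Bribery with budget zero

sumℚ≥0 : ∀ {xs} → All (0ℚ ℚ.≤_) xs → 0ℚ ℚ.≤ sumℚ xs
sumℚ≥0 []            = ℚ.≤-refl
sumℚ≥0 (x≥0 ∷ xs≥0) = ℚ.≤-trans (ℚ.≤-reflexive (sym (ℚ.+-identityˡ 0ℚ))) (ℚ.+-mono-≤ x≥0 (sumℚ≥0 xs≥0))

sumℚ≤0⇒≡0 : ∀ {xs} → All (0ℚ ℚ.≤_) xs → sumℚ xs ℚ.≤ 0ℚ → All (_≡ 0ℚ) xs
sumℚ≤0⇒≡0 []                             _   = []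
sumℚ≤0⇒≡0 {x ∷ xs} (x≥0 ∷ xs≥0) sum≤0 =
  ℚ.≤-antisym (ℚ.≤-trans (ℚ.≤-trans (ℚ.≤-reflexive (sym (ℚ.+-identityʳ x))) (ℚ.+-monoʳ-≤ x (sumℚ≥0 xs≥0))) sum≤0) x≥0 ∷
  sumℚ≤0⇒≡0 xs≥0 (ℚ.≤-trans (ℚ.≤-trans (ℚ.≤-reflexive (sym (ℚ.+-identityˡ (sumℚ xs)))) (ℚ.+-monoˡ-≤ (sumℚ xs) x≥0)) sum≤0)

sumℚ≡0 : ∀ {xs} → All (_≡ 0ℚ) xs → sumℚ xs ≡ 0ℚ
sumℚ≡0 []             = refl
sumℚ≡0 (refl ∷ xs≡0) = trans (ℚ.+-identityˡ _) (sumℚ≡0 xs≡0)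

-- Swaps are oriented, and the two orientations of a pair may differ in cost. Only the one with the
-- upper candidate of `v` first can invert the pair, so its cost decides.
Respects : ∀ {m} → (Swap m → ℚ) → Vote m → Vote m → Set
Respects c v w = ∀ a b .(a≢b : a ≢ b) → pos v a ℕ.< pos v b → c (mkSwap a b a≢b) ≢ 0ℚ → pos w a ℕ.< pos w b

module _ (E : ElectionSystem) (x : SwapBriberyInstance) where
  open SwapBriberyInstance x

  -- The common core of both reductions: it eliminates swaps, leaving only a comparison of
  -- `Respects` with `Extends`.
  zero-budget : budget ≡ 0ℚ →
    Yes (SwapBribery E) x ⇔
    (Σ[ W ∈ Vec (Vote m) n ] (∀ i → Respects (cost i) (lookup votes i) (lookup W i)) × E m n W preferred)
  zero-budget budget≡0 = mk⇔ sound complete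
    where
    sound : Yes (SwapBribery E) x → _
    sound (Γ , W , path , cheap , win) = W , respects , win
      where
      -- Nonnegative terms of a sum that is at most 0 vanish: applied across the voters, then within
      -- each vote.
      free : ∀ i → All (λ s → cost i s ≡ 0ℚ) (elements (Γ i))
      free i = All.map⁻ (sumℚ≤0⇒≡0 (All.map⁺ (All.universal (cost≥0 i) _)) (ℚ.≤-reflexive (All.tabulate⁻
        (sumℚ≤0⇒≡0 (All.tabulate⁺ λ j → sumℚ≥0 (All.map⁺ (All.universal (cost≥0 j) (elements (Γ j)))))
                    (subst (totalCost cost Γ ℚ.≤_) budget≡0 cheap)) i)))
      respects : ∀ i → Respects (cost i) (lookup votes i) (lookup W i)
      respects i a b a≢b a<b ab≢0 with path i
      ... | σ , σ↭Γ , steps = path-keeps steps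
        (All.map (λ { s≡0 (refl , refl) → ab≢0 s≡0 }) (All-resp-↭ (↭-sym σ↭Γ) (free i))) a<b

    complete : _ → Yes (SwapBribery E) x
    complete (W , respects , win) = Γ , W , path , cheap , win
      where
      Γ : Fin n → SwapSet m
      Γ i with sorting-path (lookup votes i) (lookup W i)
      ... | σ , _ , _ , unique = mkSwapSet σ unique
      path : ∀ i → lookup votes i ⟶^ Γ i , lookup W i
      path i with sorting-path (lookup votes i) (lookup W i)
      ... | σ , steps , _ , _ = σ , ↭-refl , steps
      free : ∀ i → All (λ s → cost i s ≡ 0ℚ) (elements (Γ i))
      free i with sorting-path (lookup votes i) (lookup W i)
      -- A nonzero cost would forbid the inversion; equality with 0 is decidable, so refuting this
      -- suffices.
      ... | σ , _ , inverted , _ = All.map (λ { {mkSwap a b a≢b} (a<b , b<a) →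
        decidable-stable (_ ℚ.≟ _) λ ab≢0 → <-asym b<a (respects i a b a≢b a<b ab≢0) }) inverted
      cheap : totalCost cost Γ ℚ.≤ budget
      cheap = ℚ.≤-reflexive (trans (sumℚ≡0 (All.tabulate⁺ λ i → sumℚ≡0 (All.map⁺ (free i)))) (sym budget≡0))

-- Transitive closure (Warshall)

Matrix : ℕ → Set
Matrix m = Fin m → Fin m → Bool

through : ∀ {m} → Matrix m → Fin m → Matrix m
through M k i j = M i j ∨ (M i k ∧ M k j)

closure : ∀ {m} → Matrix m → Matrix m
closure M = foldl through M (allFin _)

through-elim : ∀ {m} (M : Matrix m) k {i j} → T (through M k i j) → T (M i j) ⊎ T (M i k) × T (M k j)
through-elim M k t with to T-∨ t
... | inj₁ ij = inj₁ ij
... | inj₂ ikj = inj₂ (to T-∧ ikj)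

through-⊇ : ∀ {m} (M : Matrix m) k {i j} → T (M i j) → T (through M k i j)
through-⊇ M k = from T-∨ ∘ inj₁

through-via : ∀ {m} (M : Matrix m) k {i j} → T (M i k) → T (M k j) → T (through M k i j)
through-via M k ik kj = from T-∨ (inj₂ (from T-∧ (ik , kj)))

closure-⊇ : ∀ {m} (M : Matrix m) {i j} → T (M i j) → T (closure M i j)
closure-⊇ M = go (allFin _) M
  where
  go : ∀ ks M {i j} → T (M i j) → T (foldl through M ks i j)
  go []       M ij = ij
  go (k ∷ ks) M ij = go ks (through M k) (through-⊇ M k ij)

-- With the order of a vote as `R`, this yields both the irreflexivity of the closure and that a
-- vote compatible with `M` extends the closure.
closure-least : ∀ {m} (M : Matrix m) (R : Fin m → Fin m → Set) →
  (∀ {i j k} → R i j → R j k → R i k) → (∀ {i j} → T (M i j) → R i j) →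
  ∀ {i j} → T (closure M i j) → R i j
closure-least M R R-trans = go (allFin _) M
  where
  go : ∀ ks M → (∀ {i j} → T (M i j) → R i j) → ∀ {i j} → T (foldl through M ks i j) → R i j
  go []       M M⊆R = M⊆R
  go (k ∷ ks) M M⊆R = go ks (through M k) λ t → case (through-elim M k t)
    where
    case : ∀ {i j} → T (M i j) ⊎ T (M i k) × T (M k j) → R i j
    case (inj₁ ij)        = M⊆R ij
    case (inj₂ (ik , kj)) = R-trans (M⊆R ik) (M⊆R kj)

-- Transitivity restricted to the intermediate point `k`. Warshall's rounds establish it for one
-- point after another without destroying it for earlier ones.
Via : ∀ {m} → Matrix m → Fin m → Set
Via M k = ∀ {i j} → T (M i k) → T (M k j) → T (M i j)

-- Going through `k` adds no pair that starts or ends at `k`, so both hypotheses already hold in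
-- `M`.
via-through : ∀ {m} (M : Matrix m) k → Via (through M k) k
via-through M k ik kj = through-via M k (source (through-elim M k ik)) (target (through-elim M k kj))
  where
  source : ∀ {i} → T (M i k) ⊎ T (M i k) × T (M k k) → T (M i k)
  source (inj₁ ik)       = ik
  source (inj₂ (ik , _)) = ik
  target : ∀ {j} → T (M k j) ⊎ T (M k k) × T (M k j) → T (M k j)
  target (inj₁ kj)       = kj
  target (inj₂ (_ , kj)) = kj

through-keeps-via : ∀ {m} (M : Matrix m) k {l} → Via M l → Via (through M k) l
through-keeps-via M k {l} via {i} {j} il lj with through-elim M k il | through-elim M k lj
... | inj₁ il        | inj₁ lj        = through-⊇ M k (via il lj)
... | inj₁ il        | inj₂ (lk , kj) = through-via M k (via il lk) kj
... | inj₂ (ik , kl) | inj₁ lj        = through-via M k ik (via kl lj)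
-- The walk visits `k` before and after `l`; the detour between the two visits is cut out.
... | inj₂ (ik , _)  | inj₂ (_ , kj)  = through-via M k ik kj

closure-trans : ∀ {m} (M : Matrix m) {i j k} → T (closure M i j) → T (closure M j k) → T (closure M i k)
closure-trans M {j = j} = visited (allFin _) M (∈-allFin j)
  where
  keeps : ∀ ks M {l} → Via M l → Via (foldl through M ks) l
  keeps []       M via = via
  keeps (k ∷ ks) M via = keeps ks (through M k) (through-keeps-via M k via)
  visited : ∀ ks M {l} → l List.∈ ks → Via (foldl through M ks) l
  visited (k ∷ ks) M (here refl) = keeps ks (through M k) (via-through M k)
  visited (k ∷ ks) M (there l∈)  = visited ks (through M k) l∈

closureVote : ∀ {m} (M : Matrix m) (v : Vote m) → (∀ {i j} → T (M i j) → pos v i ℕ.< pos v j) → PartialVote m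
closureVote M v M⊆v = record
  { prefers = closure M
  ; isStrictPartialOrder = record
    { isEquivalence = isEquivalence
    ; irrefl        = λ { refl ii → <-irrefl refl (closure-least M (λ i j → pos v i ℕ.< pos v j) <-trans M⊆v ii) }
    ; trans         = closure-trans M
    ; <-resp-≈      = (λ { refl → id }) , (λ { refl → id })
    }
  }

extends-closure : ∀ {m} (M : Matrix m) v {M⊆v : ∀ {i j} → T (M i j) → pos v i ℕ.< pos v j} (w : Vote m) →
  w Extends closureVote M v (λ {i} {j} → M⊆v {i} {j}) ⇔ (∀ i j → T (M i j) → pos w i ℕ.< pos w j)
extends-closure M v w = mk⇔ (λ ext i j ij → ext i j (closure-⊇ M ij)) (λ M⊆w _ _ → closure-least M (λ i j → pos w i ℕ.< pos w j) <-trans (M⊆w _ _))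

-- R d c makes the down-set of d a proper subset of that of c, so sorting by the
-- sizes of the down-sets extends R.

below : ∀ {m} → Matrix m → Fin m → ℕ
below R c = ∣ tabulate (λ d → R d c) ∣

-- Lexicographic order by size of the down-set, then by index. Breaking ties makes it total, so the
-- numbers of predecessors are distinct ranks.
before : ∀ {m} → Matrix m → Matrix m
before R d c = (below R d <ᵇ below R c) ∨ (not (below R c <ᵇ below R d) ∧ (toℕ d <ᵇ toℕ c))

position : ∀ {m} → Matrix m → Fin m → ℕ
position R = below (before R)

module _ {m} (R : Matrix m) where

  private
    Lex : Fin m → Fin m → Set
    Lex d c = below R d ℕ.< below R c ⊎ ¬ below R c ℕ.< below R d × toℕ d ℕ.< toℕ c

    lex⁺ : ∀ {d c} → Lex d c → T (before R d c)
    lex⁺ {d} {c} (inj₁ lt)        = from T-∨ (inj₁ (<⇒<ᵇ lt))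
    lex⁺ {d} {c} (inj₂ (≥ , d<c)) = from (T-∨ {below R d <ᵇ below R c}) (inj₂ (from T-∧ (T-not⁺ _ (≥ ∘ <ᵇ⇒< _ _) , <⇒<ᵇ d<c)))
      where
      T-not⁺ : ∀ b → ¬ T b → T (not b)
      T-not⁺ false _  = tt
      T-not⁺ true  ¬t = ¬t tt

    lex⁻ : ∀ {d c} → T (before R d c) → Lex d c
    lex⁻ {d} {c} t with to (T-∨ {below R d <ᵇ below R c}) t
    ... | inj₁ lt = inj₁ (<ᵇ⇒< _ _ lt)
    ... | inj₂ t′ with to (T-∧ {not (below R c <ᵇ below R d)}) t′
    ... | ≥ , d<c = inj₂ (T-not⁻ _ ≥ ∘ <⇒<ᵇ , <ᵇ⇒< _ _ d<c)
      where
      T-not⁻ : ∀ b → T (not b) → ¬ T b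
      T-not⁻ false _ ()

    lex-irrefl : ∀ {c} → ¬ Lex c c
    lex-irrefl (inj₁ lt)      = <-irrefl refl lt
    lex-irrefl (inj₂ (_ , lt)) = <-irrefl refl lt

    lex-trans : ∀ {c d e} → Lex c d → Lex d e → Lex c e
    lex-trans (inj₁ p)        (inj₁ q)        = inj₁ (<-trans p q)
    lex-trans (inj₁ p)        (inj₂ (q , _))  = inj₁ (<-≤-trans p (≮⇒≥ q))
    lex-trans (inj₂ (p , _))  (inj₁ q)        = inj₁ (≤-<-trans (≮⇒≥ p) q)
    lex-trans (inj₂ (p , p′)) (inj₂ (q , q′)) =
      inj₂ ((λ e<c → p (≤-<-trans (≮⇒≥ q) e<c)) , <-trans p′ q′)

  before-mono : ∀ {c d} → T (before R c d) → position R c ℕ.< position R d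
  before-mono {c} {d} c<d = ∣tabulate∣-mono-< (λ e → before R e c) (λ e → before R e d)
    (λ e e<c → lex⁺ (lex-trans (lex⁻ e<c) (lex⁻ c<d))) c c<d (lex-irrefl ∘ lex⁻)

  position<m : ∀ c → position R c ℕ.< m
  position<m c = <-≤-trans
    (∣tabulate∣-mono-< (λ d → before R d c) (λ _ → true) (λ _ _ → tt) c tt (lex-irrefl ∘ lex⁻)) (∣p∣≤n (tabulate {n = m} λ _ → true))

  position-injective : ∀ {c d} → position R c ≡ position R d → c ≡ d
  position-injective {c} {d} eq with <-cmp (below R c) (below R d)
  ... | tri< lt _ _ = contradiction (before-mono (lex⁺ (inj₁ lt))) (<-irrefl eq)
  ... | tri> _ _ gt = contradiction (before-mono (lex⁺ (inj₁ gt))) (<-irrefl (sym eq))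
  ... | tri≈ ≮ _ ≯ with <-cmp (toℕ c) (toℕ d)
  ...   | tri< lt _ _ = contradiction (before-mono (lex⁺ (inj₂ (≯ , lt)))) (<-irrefl eq)
  ...   | tri≈ _ c≡d _ = toℕ-injective c≡d
  ...   | tri> _ _ gt = contradiction (before-mono (lex⁺ (inj₂ (≮ , gt)))) (<-irrefl (sym eq))

linearise : ∀ {m} → PartialVote m → Vote m
linearise u = mkVote (tabulate rank′) λ {c} {d} eq → position-injective (prefers u)
  (fromℕ<-injective _ _ _ _ (trans (sym (lookup∘tabulate rank′ c)) (trans eq (lookup∘tabulate rank′ d))))
  where
  rank′ : Fin _ → Fin _
  rank′ c = fromℕ< (position<m (prefers u) c)

pos-linearise : ∀ {m} (u : PartialVote m) c → pos (linearise u) c ≡ position (prefers u) c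
pos-linearise u c = trans (cong toℕ (lookup∘tabulate _ c)) (toℕ-fromℕ< (position<m (prefers u) c))

linearise-extends : ∀ {m} (u : PartialVote m) → linearise u Extends u
linearise-extends u a b ab = subst₂ ℕ._<_ (sym (pos-linearise u a)) (sym (pos-linearise u b))
  (before-mono R (from T-∨ (inj₁ (<⇒<ᵇ below<))))
  where
  R = prefers u
  open IsStrictPartialOrder (isStrictPartialOrder u) renaming (trans to R-trans)
  below< : below R a ℕ.< below R b
  below< = ∣tabulate∣-mono-< (λ d → R d a) (λ d → R d b) (λ d da → R-trans da ab) a ab (irrefl refl)

-- Reductions from tree functions; matrices as trees

polyTime : ∀ {A B g} (f : Instance A → Instance B) → Poly g →
  (∀ x → g (code A x) ≡ code B (f x)) → PolyTime A B f
polyTime {A} {B} f G sim = program G , degree (bound G) , λ x → bounded x (runs G (code A x))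
  where
  open Poly
  bounded : ∀ x → _ → _
  bounded x (t , r , t≤) = t , subst (program G ⊢ code A x ⇓_⟨ t ⟩) (sim x) r ,
    ≤-trans t≤ (≤-trans (eval≤power (bound G) (size (code A x)) {{>-nonZero (size≥1 (code A x))}}) (m≤m+n _ _))

codeMatrix : ∀ {m} → Matrix m → Tree
codeMatrix M = codeTable λ a → codeTable λ b → codeBool (M a b)

entry : Tree → Tree → Tree → Tree
entry M i j = nth j (nth i M)

entryᴾ : ∀ {M i j} → Poly M → Poly i → Poly j → Poly (λ x → entry (M x) (i x) (j x))
entryᴾ M I J = nthᴾ J (nthᴾ I M)

entry-code : ∀ {m} (f : Fin m → Fin m → Tree) i j →
  entry (codeTable λ a → codeTable (f a)) (codeFin i) (codeFin j) ≡ f i j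
entry-code f i j = trans (cong (nth (codeFin j)) (nth-code (λ a → codeTable (f a)) i)) (nth-code (f i) j)

bool : Tree → Tree
bool t = cond t trueᵀ nil

boolᴾ : ∀ {f} → Poly f → Poly (λ x → bool (f x))
boolᴾ F = condᴾ F (expr (cons nil nil)) (expr nil)

isNode : Tree → Bool
isNode nil     = false
isNode (_ ∙ _) = true

bool-isNode : ∀ t → bool t ≡ codeBool (isNode t)
bool-isNode nil     = refl
bool-isNode (_ ∙ _) = refl

bool-code : ∀ b → bool (codeBool b) ≡ codeBool b
bool-code false = refl
bool-code true  = refl

grid : (Tree → Tree → Tree) → Tree → Tree
grid h l = map (λ a → map (h a) l) l

grid-code : ∀ {m} h (g : Fin m → Fin m → Tree) → (∀ a b → h (codeFin a) (codeFin b) ≡ g a b) →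
  grid h (codeTable {m} codeFin) ≡ codeTable λ a → codeTable (g a)
grid-code h g h≡g = map-code-≗ _ codeFin λ a → map-code-≗ _ codeFin (h≡g a)

gridᴾ : ∀ {h l} → Poly h → Poly l → Poly (λ x → grid (λ a b → h (b ∙ a ∙ x)) (l x))
gridᴾ H L = mapᴾ (mapᴾ H (L ⊚ expr (tl X))) L

-- From Swap Bribery to Possible Winner

throughᵀ : Tree → Tree → Tree → Tree
throughᵀ l k M = grid (λ i j → cond (entry M i j) trueᵀ (cond (entry M i k) (bool (entry M k j)) nil)) l

-- Each cell is rebuilt as a truth value of size at most 3, so a row has size at most `4 * size l`.
-- The bound does not involve `M`, as `Growth` requires.
size-throughᵀ : ∀ l k M → size (throughᵀ l k M) ≤ suc (4 * size l) * size l
size-throughᵀ l k M = size-map _ l (4 * size l) λ i → size-map _ l 3 λ j → small (entry M i j) (entry M i k) (entry M k j)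
  where
  small : ∀ r s t → size (cond r trueᵀ (cond s (bool t) nil)) ≤ 3
  small nil     nil     t       = s≤s z≤n
  small nil     (_ ∙ _) nil     = s≤s z≤n
  small nil     (_ ∙ _) (_ ∙ _) = ≤-refl
  small (_ ∙ _) s       t       = ≤-refl

throughᵀ-code : ∀ {m} (M : Matrix m) k →
  throughᵀ (codeTable {m} codeFin) (codeFin k) (codeMatrix M) ≡ codeMatrix (through M k)
throughᵀ-code M k = grid-code _ _ cell
  where
  cell : ∀ i j → cond (entry (codeMatrix M) (codeFin i) (codeFin j)) trueᵀ
      (cond (entry (codeMatrix M) (codeFin i) (codeFin k)) (bool (entry (codeMatrix M) (codeFin k) (codeFin j))) nil)
    ≡ codeBool (through M k i j)
  cell i j
    rewrite entry-code (λ a b → codeBool (M a b)) i j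
          | entry-code (λ a b → codeBool (M a b)) i k
          | entry-code (λ a b → codeBool (M a b)) k j
          | bool-code (M k j)
          | ∧-code (M i k) (M k j)
    = ∨-code (M i j) (M i k ∧ M k j)

closureᵀ : Tree → Tree → Tree
closureᵀ l M = fold (λ k M → throughᵀ l k M) M l

closureᵀ-code : ∀ {m} (M : Matrix m) → closureᵀ (codeTable {m} codeFin) (codeMatrix M) ≡ codeMatrix (closure M)
closureᵀ-code {m} M = fold-code _ codeMatrix codeFin id through (λ k M → throughᵀ-code M k) M

closureᴾ : ∀ {l M} → Poly l → Poly M → Poly (λ x → closureᵀ (l x) (M x))
closureᴾ {l} {M} L P = fold-tail ⊚ (P ∙ᴾ L)
  where
  -- The environment of a cell is j, i, k, the current matrix and the input of the loop, innermost
  -- first.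
  k M′ i j : Expr
  j  = hd X
  i  = hd (tl X)
  k  = hd (tl (tl X))
  M′ = hd (tl (tl (tl X)))

  cell : Poly (λ y → throughᵀ (tail (tail (tail y))) (head y) (head (tail y)))
  cell = gridᴾ
    (condᴾ (entryᴾ (expr M′) (expr i) (expr j)) (expr (cons nil nil))
      (condᴾ (entryᴾ (expr M′) (expr i) (expr k)) (boolᴾ (entryᴾ (expr M′) (expr k) (expr j))) (expr nil)))
    (expr (tl (tl (tl X))))

  growth : Growth (λ y → throughᵀ (tail (tail (tail y))) (head y) (head (tail y))) ((const 1 ⊕ const 4 ⊗ var) ⊗ var)
  growth a acc x = ≤-trans (size-throughᵀ (tail x) a acc) (≤-trans
    (*-mono-≤ (s≤s (*-monoʳ-≤ 4 l≤)) l≤) (m≤n+m _ (size acc)))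
    where
    l≤ : size (tail x) ≤ size a + size x
    l≤ = ≤-trans (size-tail x) (m≤n+m (size x) (size a))

  fold-tail : Poly (λ x → closureᵀ (tail x) (head x))
  fold-tail = foldᴾ cell ((const 1 ⊕ const 4 ⊗ var) ⊗ var) growth (expr (hd X)) (expr (tl X))

-- The tail of the head of codeℚ q codes the absolute value of the numerator, but
-- one less if q is negative; so for q ≥ 0 it is nil exactly when q = 0.  It is
-- also nil for the blank diagonal of the cost matrix.
costly : Tree → Tree
costly q = bool (tail (head q))

forced : ∀ {m} → (Swap m → ℚ) → Vote m → Matrix m
forced c v a b = (pos v a <ᵇ pos v b) ∧ isNode (tail (head (codeCost c a b)))

forcedᵀ : Tree → Tree → Tree → Tree
forcedᵀ l v c = grid (λ a b → cond (lt (nth a v) (nth b v)) (costly (entry c a b)) nil) l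

forcedᵀ-code : ∀ {m} (c : Swap m → ℚ) (v : Vote m) →
  forcedᵀ (codeTable {m} codeFin) (codeVote v) (codeCosts c) ≡ codeMatrix (forced c v)
forcedᵀ-code c v = grid-code _ _ cell
  where
  cell : ∀ a b → cond (lt (nth (codeFin a) (codeVote v)) (nth (codeFin b) (codeVote v)))
                      (costly (entry (codeCosts c) (codeFin a) (codeFin b))) nil
                 ≡ codeBool (forced c v a b)
  cell a b
    rewrite nth-code (λ c → codeFin (rank v c)) a
          | nth-code (λ c → codeFin (rank v c)) b
          | entry-code (codeCost c) a b
          | lt-code (pos v a) (pos v b)
          | bool-isNode (tail (head (codeCost c a b)))
    = ∧-code (pos v a <ᵇ pos v b) (isNode (tail (head (codeCost c a b))))

partialVotesᵀ : Tree → Tree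
partialVotesᵀ x = head x ∙
  -- Votes and cost tables are parallel lists; running over the voters' indices pairs them up.
  map (λ i → closureᵀ idx (forcedᵀ idx (nth i (head (tail x))) (nth i (head (tail (tail (tail x)))))))
      (indices (length (head (tail x))))
  ∙ head (tail (tail x))
  where
  idx = indices (head x)

partialVotesᴾ : Poly partialVotesᵀ
partialVotesᴾ = expr (hd X) ∙ᴾ
  (letᴾ indicesᴾ ⊚ expr (hd X) inᴾ
    mapᴾ (closureᴾ (expr (hd (tl X)))
                   (letᴾ (nthᴾ (expr (hd X)) (expr votes) ∙ᴾ nthᴾ (expr (hd X)) (expr costs)) inᴾ forcedᴾ))
         (indicesᴾ ⊚ lengthᴾ ⊚ expr (hd (tl (tl X)))))
  ∙ᴾ expr (hd (tl (tl X)))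
  where
  votes costs : Expr
  votes = hd (tl (tl (tl X)))
  costs = hd (tl (tl (tl (tl (tl X)))))

  forcedᴾ : Poly (λ y → forcedᵀ (head (tail (tail y))) (head (head y)) (tail (head y)))
  forcedᴾ = gridᴾ
    (condᴾ (ltᴾ (nthᴾ (expr (hd (tl X))) (expr (hd (hd (tl (tl X))))))
                 (nthᴾ (expr (hd X)) (expr (hd (hd (tl (tl X)))))))
           (boolᴾ (expr (tl (hd X)) ⊚ entryᴾ (expr (tl (hd (tl (tl X))))) (expr (hd (tl X))) (expr (hd X))))
           (expr nil))
    (expr (hd (tl (tl X))))

-- A parity test selects one of the two nonzero constructors of `ℕᵇ`, and both are coded by a pair.
isNode-codeℕ : ∀ n → T (isNode (codeℕ (suc n)))
isNode-codeℕ n with n ℕ.% 2 ℕ.≡ᵇ 0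
... | false = tt
... | true  = tt

isNode-codeℚ : ∀ q → 0ℚ ℚ.≤ q → T (isNode (tail (head (codeℚ q)))) ⇔ q ≢ 0ℚ
isNode-codeℚ q@(mkℚ (ℤ.+ zero)    _ _) q≥0 = mk⇔ (λ ()) λ q≢0 → q≢0 (ℚ.↥p≡0⇒p≡0 q refl)
isNode-codeℚ q@(mkℚ (ℤ.+ (suc n)) _ _) q≥0 = mk⇔ (λ _ ()) λ _ → isNode-codeℕ n
isNode-codeℚ q@(mkℚ ℤ.-[1+ n ]    _ _) q≥0 = contradiction (ℚ.nonNegative q≥0) λ ()

module _ {m} (c : Swap m → ℚ) (c≥0 : ∀ s → 0ℚ ℚ.≤ c s) (v : Vote m) where

  forced-⊆ : ∀ {a b} → T (forced c v a b) → pos v a ℕ.< pos v b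
  forced-⊆ t = <ᵇ⇒< _ _ (proj₁ (to T-∧ t))

  private
    isNode-codeCost : ∀ a b (a≢b : a ≢ b) →
      T (isNode (tail (head (codeCost c a b)))) ⇔ c (mkSwap a b a≢b) ≢ 0ℚ
    isNode-codeCost a b a≢b with a ≟ b
    ... | yes a≡b = contradiction a≡b a≢b
    ... | no _    = isNode-codeℚ (c (mkSwap a b a≢b)) (c≥0 _)

  respects⇔forced : ∀ w → Respects c v w ⇔ (∀ a b → T (forced c v a b) → pos w a ℕ.< pos w b)
  respects⇔forced w = mk⇔
    (λ resp a b t → let a≢b = a<b⇒a≢b (forced-⊆ t) in
      resp a b a≢b (forced-⊆ t) (to (isNode-codeCost a b a≢b) (proj₂ (to T-∧ t))))
    -- The given proof of `a ≢ b` is irrelevant; a usable one is rebuilt from `a<b`.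
    (λ forced⊆w a b .a≢b a<b ab≢0 → forced⊆w a b
      (from T-∧ (<⇒<ᵇ a<b , from (isNode-codeCost a b (a<b⇒a≢b a<b)) ab≢0)))
    where
    a<b⇒a≢b : ∀ {a b} → pos v a ℕ.< pos v b → a ≢ b
    a<b⇒a≢b a<b refl = <-irrefl refl a<b

winning-cong : ∀ {A : Set} {P Q R : A → Set} → (∀ w → P w ⇔ Q w) →
  (Σ[ w ∈ A ] P w × R w) ⇔ (Σ[ w ∈ A ] Q w × R w)
winning-cong P⇔Q = mk⇔ (λ (w , p , r) → w , to (P⇔Q w) p , r) (λ (w , q , r) → w , from (P⇔Q w) q , r)

module _ (x : SwapBriberyInstance) where
  open SwapBriberyInstance x

  partialVote : Fin n → PartialVote m
  partialVote i = closureVote (forced (cost i) (lookup votes i)) (lookup votes i)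
                              (forced-⊆ (cost i) (cost≥0 i) (lookup votes i))

  toPossibleWinner : PossibleWinnerInstance
  toPossibleWinner = record { m = m ; n = n ; votes = tabulate partialVote ; preferred = preferred }

  respects⇔extends : ∀ i w → Respects (cost i) (lookup votes i) w ⇔ w Extends lookup (tabulate partialVote) i
  respects⇔extends i w rewrite lookup∘tabulate partialVote i =
    ⇔-sym (extends-closure (forced (cost i) (lookup votes i)) (lookup votes i) {forced-⊆ (cost i) (cost≥0 i) (lookup votes i)} w) ⇔-∘
    respects⇔forced (cost i) (cost≥0 i) (lookup votes i) w

  partialVotesᵀ-code : ∀ E → partialVotesᵀ (code (SwapBribery E) x) ≡ code (PossibleWinner E) toPossibleWinner
  partialVotesᵀ-code E
    rewrite length-code (λ i → codeVote (lookup votes i)) | indices-code m | indices-code n =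
    cong (λ t → codeUnary m ∙ t ∙ codeFin preferred) (map-code-≗ _ codeFin voteᵀ)
    where
    idx V C : Tree
    idx = codeTable {m} codeFin
    V = codeTable λ i → codeVote (lookup votes i)
    C = codeTable λ i → codeCosts (cost i)
    voteᵀ : ∀ i → closureᵀ idx (forcedᵀ idx (nth (codeFin i) V) (nth (codeFin i) C))
                  ≡ codePartialVote (lookup (tabulate partialVote) i)
    voteᵀ i
      rewrite nth-code (λ i → codeVote (lookup votes i)) i | nth-code (λ i → codeCosts (cost i)) i
            | forcedᵀ-code (cost i) (lookup votes i) | lookup∘tabulate partialVote i
      = closureᵀ-code (forced (cost i) (lookup votes i))

SwapBribery≤PossibleWinner : ∀ E δ → Restrict (SwapBribery E) (ZeroOrδ δ) ≤ₚ PossibleWinner E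
SwapBribery≤PossibleWinner E δ = toPossibleWinner ∘ proj₁ ,
  (λ (x , _ , budget≡0) → winning-cong (λ W → mk⇔
      (λ resp i → to (respects⇔extends x i (lookup W i)) (resp i))
      (λ ext i → from (respects⇔extends x i (lookup W i)) (ext i)))
    ⇔-∘ zero-budget E x budget≡0) ,
  polyTime {Restrict (SwapBribery E) (ZeroOrδ δ)} {PossibleWinner E} (toPossibleWinner ∘ proj₁) partialVotesᴾ (λ (x , _) → partialVotesᵀ-code x E)

-- From Possible Winner to Swap Bribery

-- The number δ is fixed by the problem, not part of an instance, so its code may be written into
-- the program.
quoted : Tree → Expr
quoted nil     = nil
quoted (s ∙ t) = cons (quoted s) (quoted t)

⟦quoted⟧ : ∀ t x → ⟦ quoted t ⟧ x ≡ t
⟦quoted⟧ nil     x = refl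
⟦quoted⟧ (s ∙ t) x = cong₂ _∙_ (⟦quoted⟧ s x) (⟦quoted⟧ t x)

constᴾ : ∀ t → Poly (λ _ → t)
constᴾ t = Poly-resp (⟦quoted⟧ t) (expr (quoted t))

belowᵀ : Tree → (Tree → Tree → Tree) → Tree
belowᵀ l r = map (λ c → count (λ d → r d c) l) l

belowᵀ-code : ∀ {m} r (R : Matrix m) → (∀ d c → r (codeFin d) (codeFin c) ≡ codeBool (R d c)) →
  belowᵀ (codeTable {m} codeFin) r ≡ codeTable (λ c → codeUnary (below R c))
belowᵀ-code r R r≡R = map-code-≗ _ codeFin λ c → count-code _ codeFin (λ d → R d c) (λ d → r≡R d c)

belowᴾ : ∀ {r l} → Poly r → Poly l → Poly (λ x → belowᵀ (l x) (λ d c → r (d ∙ c ∙ x)))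
belowᴾ R L = mapᴾ (countᴾ R (L ⊚ expr (tl X))) L

beforeᵀ : Tree → Tree → Tree → Tree
beforeᵀ B d c = cond (lt (nth d B) (nth c B)) trueᵀ (cond (lt (nth c B) (nth d B)) nil (lt d c))

-- Predecessors are counted twice: in the partial order, for the sizes of the down-sets, and then in
-- `before`, for the ranks.
voteᵀ : Tree → Tree → Tree
voteᵀ l u = belowᵀ l (beforeᵀ (belowᵀ l (entry u)))

voteᵀ-code : ∀ {m} (u : PartialVote m) → voteᵀ (codeTable {m} codeFin) (codePartialVote u) ≡ codeVote (linearise u)
voteᵀ-code {m} u
  rewrite belowᵀ-code {m} (entry (codePartialVote u)) (prefers u) (entry-code (λ a b → codeBool (prefers u a b))) =
  trans (belowᵀ-code {m} _ (before R) cell) (codeTable-cong λ c → cong codeUnary (sym (pos-linearise u c)))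
  where
  R = prefers u
  B = codeTable λ c → codeUnary (below R c)
  not-code : ∀ b c → cond (codeBool b) nil (codeBool c) ≡ codeBool (not b ∧ c)
  not-code false c = refl
  not-code true  c = refl
  cell : ∀ d c → beforeᵀ B (codeFin d) (codeFin c) ≡ codeBool (before R d c)
  cell d c
    rewrite nth-code (λ c → codeUnary (below R c)) d | nth-code (λ c → codeUnary (below R c)) c
          | lt-code (below R d) (below R c) | lt-code (below R c) (below R d) | lt-code (toℕ d) (toℕ c)
          | not-code (below R c <ᵇ below R d) (toℕ d <ᵇ toℕ c)
    = ∨-code (below R d <ᵇ below R c) (not (below R c <ᵇ below R d) ∧ (toℕ d <ᵇ toℕ c))

voteᴾ : Poly (λ x → voteᵀ (head (tail x)) (head x))
voteᴾ = letᴾ belowᴾ (entryᴾ (expr (hd (tl (tl X)))) (expr (hd X)) (expr (hd (tl X)))) (expr (hd (tl X))) inᴾ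
  belowᴾ (condᴾ (ltᴾ (nthᴾ d B) (nthᴾ c B)) (expr (cons nil nil))
                 (condᴾ (ltᴾ (nthᴾ c B) (nthᴾ d B)) (expr nil) (ltᴾ d c)))
          (expr (hd (tl (tl X))))
  where
  d = expr (hd X)
  c = expr (hd (tl X))
  B = expr (hd (tl (tl X)))

choose : Bool → ℚ → ℚ
choose false δ = 0ℚ
choose true  δ = δ

swapCost : ∀ {m} → ℚ → PartialVote m → Swap m → ℚ
swapCost δ u (mkSwap a b _) = choose (prefers u a b) δ

-- The test that one index is less than the other detects a ≠ b, so the diagonal stays blank as in
-- `codeCost`.
costᵀ : Tree → Tree → Tree → Tree
costᵀ δ l u = grid (λ a b → cond (cond (lt a b) trueᵀ (lt b a)) (cond (entry u a b) δ (codeℚ 0ℚ)) nil) l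

costᵀ-code : ∀ {m} δ (u : PartialVote m) →
  costᵀ (codeℚ δ) (codeTable {m} codeFin) (codePartialVote u) ≡ codeCosts (swapCost δ u)
costᵀ-code δ u = grid-code _ _ cell
  where
  R = prefers u
  apart : ∀ i j t → i ≢ j → cond (codeBool ((i <ᵇ j) ∨ (j <ᵇ i))) t nil ≡ t
  apart zero    zero    t i≢j = contradiction refl i≢j
  apart zero    (suc j) t i≢j = refl
  apart (suc i) zero    t i≢j = refl
  apart (suc i) (suc j) t i≢j = apart i j t (i≢j ∘ cong suc)
  diagonal : ∀ i t → cond (codeBool ((i <ᵇ i) ∨ (i <ᵇ i))) t nil ≡ nil
  diagonal zero    t = refl
  diagonal (suc i) t = diagonal i t
  choose-code : ∀ b → cond (codeBool b) (codeℚ δ) (codeℚ 0ℚ) ≡ codeℚ (choose b δ)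
  choose-code false = refl
  choose-code true  = refl
  cell : ∀ a b → cond (cond (lt (codeFin a) (codeFin b)) trueᵀ (lt (codeFin b) (codeFin a)))
                      (cond (entry (codePartialVote u) (codeFin a) (codeFin b)) (codeℚ δ) (codeℚ 0ℚ)) nil
                 ≡ codeCost (swapCost δ u) a b
  cell a b
    rewrite lt-code (toℕ a) (toℕ b) | lt-code (toℕ b) (toℕ a) | ∨-code (toℕ a <ᵇ toℕ b) (toℕ b <ᵇ toℕ a)
          | entry-code (λ a b → codeBool (prefers u a b)) a b
    with a ≟ b
  ... | yes refl = diagonal (toℕ a) _
  ... | no a≢b = trans (apart (toℕ a) (toℕ b) _ (a≢b ∘ toℕ-injective)) (choose-code (R a b))

costᴾ : ∀ δ → Poly (λ x → costᵀ δ (head (tail x)) (head x))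
costᴾ δ = gridᴾ
  (condᴾ (condᴾ (ltᴾ a b) (expr (cons nil nil)) (ltᴾ b a))
         (condᴾ (entryᴾ (expr (hd (tl (tl X)))) a b) (constᴾ δ) (constᴾ (codeℚ 0ℚ)))
         (expr nil))
  (expr (hd (tl X)))
  where
  a = expr (hd (tl X))
  b = expr (hd X)

briberyᵀ : Tree → Tree → Tree
briberyᵀ δ x =
  head x ∙ map (voteᵀ idx) (head (tail x)) ∙ tail (tail x) ∙ map (costᵀ δ idx) (head (tail x)) ∙ codeℚ 0ℚ
  where
  idx = indices (head x)

briberyᴾ : ∀ δ → Poly (briberyᵀ δ)
briberyᴾ δ = letᴾ indicesᴾ ⊚ expr (hd X) inᴾ
  expr (hd (tl X)) ∙ᴾ mapᴾ voteᴾ votes ∙ᴾ expr (tl (tl (tl X))) ∙ᴾ mapᴾ (costᴾ δ) votes ∙ᴾ constᴾ (codeℚ 0ℚ)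
  where
  votes = expr (hd (tl (tl X)))

module _ (δ : ℚ) (0<δ : 0ℚ ℚ.< δ) where

  choose≥0 : ∀ b → 0ℚ ℚ.≤ choose b δ
  choose≥0 false = ℚ.≤-refl
  choose≥0 true  = ℚ.<⇒≤ 0<δ

  choose-0δ : ∀ b → choose b δ ≡ 0ℚ ⊎ choose b δ ≡ δ
  choose-0δ false = inj₁ refl
  choose-0δ true  = inj₂ refl

  choose≢0 : ∀ b → choose b δ ≢ 0ℚ ⇔ T b
  choose≢0 false = mk⇔ (λ ≢0 → ≢0 refl) λ ()
  choose≢0 true  = mk⇔ (λ _ → tt) λ _ δ≡0 → ℚ.<-irrefl (sym δ≡0) 0<δ

  -- As δ is positive, a nonzero cost marks exactly the pairs ordered by `u`, and `linearise u`
  -- already ranks these in the right order.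
  respects⇔extends-linearise : ∀ {m} (u : PartialVote m) w → Respects (swapCost δ u) (linearise u) w ⇔ w Extends u
  respects⇔extends-linearise u w = mk⇔
    (λ resp a b ab → resp a b (λ { refl → <-irrefl refl (linearise-extends u a b ab) })
      (linearise-extends u a b ab) (from (choose≢0 (prefers u a b)) ab))
    (λ ext a b ._ _ ab≢0 → ext a b (to (choose≢0 (prefers u a b)) ab≢0))

  module _ (x : PossibleWinnerInstance) where
    open PossibleWinnerInstance x

    toSwapBribery : SwapBriberyInstance
    toSwapBribery = record
      { m = m ; n = n
      ; votes = tabulate λ i → linearise (lookup votes i)
      ; preferred = preferred
      ; cost = λ i → swapCost δ (lookup votes i)
      ; cost≥0 = λ { i (mkSwap a b _) → choose≥0 (prefers (lookup votes i) a b) }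
      ; budget = 0ℚ
      }

    toSwapBribery-0δ : ZeroOrδ δ toSwapBribery
    toSwapBribery-0δ = (λ { i (mkSwap a b _) → choose-0δ (prefers (lookup votes i) a b) }) , refl

    respects⇔extends-votes : ∀ i w →
      Respects (swapCost δ (lookup votes i)) (lookup (SwapBriberyInstance.votes toSwapBribery) i) w
        ⇔ w Extends lookup votes i
    respects⇔extends-votes i w rewrite lookup∘tabulate (λ i → linearise (lookup votes i)) i =
      respects⇔extends-linearise (lookup votes i) w

    briberyᵀ-code : ∀ E → briberyᵀ (codeℚ δ) (code (PossibleWinner E) x) ≡ code (SwapBribery E) toSwapBribery
    briberyᵀ-code E rewrite indices-code m = cong₂ (λ s t → codeUnary m ∙ s ∙ codeFin preferred ∙ t ∙ codeℚ 0ℚ)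
      (map-code-≗ _ (λ i → codePartialVote (lookup votes i)) λ i → trans (voteᵀ-code (lookup votes i))
        (cong codeVote (sym (lookup∘tabulate (λ i → linearise (lookup votes i)) i))))
      (map-code-≗ _ (λ i → codePartialVote (lookup votes i)) λ i → costᵀ-code δ (lookup votes i))

  PossibleWinner≤SwapBribery : ∀ E → PossibleWinner E ≤ₚ Restrict (SwapBribery E) (ZeroOrδ δ)
  PossibleWinner≤SwapBribery E = reduce ,
    (λ x → ⇔-sym (winning-cong (λ W → mk⇔
        (λ resp i → to (respects⇔extends-votes x i (lookup W i)) (resp i))
        (λ ext i → from (respects⇔extends-votes x i (lookup W i)) (ext i)))
      ⇔-∘ zero-budget E (toSwapBribery x) refl)) ,
    polyTime {PossibleWinner E} {Restrict (SwapBribery E) (ZeroOrδ δ)} reduce (briberyᴾ (codeℚ δ)) (λ x → briberyᵀ-code x E)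
    where
    reduce : PossibleWinnerInstance → Instance (Restrict (SwapBribery E) (ZeroOrδ δ))
    reduce x = toSwapBribery x , toSwapBribery-0δ x

proposition2 : (E : ElectionSystem) (δ : ℚ) → 0ℚ < δ →
    (Restrict (SwapBribery E) (ZeroOrδ δ) ≤ₚ PossibleWinner E)
    × (PossibleWinner E ≤ₚ Restrict (SwapBribery E) (ZeroOrδ δ))
proposition2 E δ 0<δ = SwapBribery≤PossibleWinner E δ , PossibleWinner≤SwapBribery δ 0<δ E
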